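{- For all closed terms $t_0,t_1$ of $\lambda_S$: $t_0\cong t_1$ iff $(\emptyset,\emptyset,t_0)\approx_{env}(\emptyset,\emptyset,t_1)$; and $t_0\cong_p t_1$ iff $(\emptyset,\emptyset,t_0)\approx_{env}^{p}(\emptyset,\emptyset,t_1)$.
   Context: Calculus $\lambda_S$: terms $t ::= v \mid t\,t \mid \mathcal{S}k.t \mid \langle t\rangle$, values $v ::= x \mid \lambda x.t$; pure contexts $E ::= \square \mid v\,E \mid E\,t$; evaluation contexts $F ::= \square \mid v\,F \mid F\,t \mid \langle F\rangle$ (every evaluation context is either pure or uniquely of the form $F[\langle E\rangle]$ with $E$ pure); contexts $C ::= \square \mid \lambda x.C \mid t\,C \mid C\,t \mid \mathcal{S}k.C \mid \langle C\rangle$. Reduction: $F[(\lambda x.t)\,v] \to F[t\{v/x\}]$; $F[\langle E[\mathcal{S}k.t]\rangle] \to F[\langle t\{\lambda x.\langle E[x]\rangle/k\}\rangle]$ ($x\notin\mathrm{fv}(E)$); $F[\langle v\rangle]\to F[v]$. Stuck: non-value that does not reduce; control-stuck: $E[\mathcal{S}k.t]$; normal form: value or stuck; $t\Downarrow t'$: $t\to^* t'$, $t'$ normal form. $s\hookrightarrow s'$ iff $s\to s'$, or $s$ is a normal form and $s'=s$. Contextual equivalences (closed terms): $t_0\cong t_1$ iff for every closed $C$, $C[t_0]$ evaluates to a value iff $C[t_1]$ does, and $C[t_0]$ evaluates to a control-stuck term iff $C[t_1]$ does; $t_0\cong_p t_1$ iff for every closed $C$, $\langle C[t_0]\rangle$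 evaluates to a value iff $\langle C[t_1]\rangle$ does. Multi-hole contexts: $\mathbb{C} ::= \mathbb{V} \mid \mathbb{C}\,\mathbb{C} \mid \langle\mathbb{C}\rangle \mid \mathcal{S}k.\mathbb{C} \mid \blacksquare_j[\mathbb{C}]$; $\mathbb{V} ::= x \mid \lambda x.\mathbb{C} \mid \square_i$; $\mathbb{F} ::= \square \mid \mathbb{F}\,\mathbb{C} \mid \mathbb{V}\,\mathbb{F} \mid \langle\mathbb{F}\rangle \mid \blacksquare_j[\mathbb{F}]$ ($i,j\ge1$). For a finite sequence $\Gamma$ of closed values and a finite sequence $\Phi$ of closed evaluation contexts, $\mathbb{C}[\Phi;\Gamma]$ replaces each $\square_i$ by $\Gamma_i$ and each $\blacksquare_j[\cdot]$ by plugging into $\Phi_j$ (indices assumed in range); $\mathbb{F}[t;\Phi;\Gamma]$ additionally fills the hole $\square$ with $t$, and $\mathbb{F}[\Phi;\Gamma]$ is the resulting evaluation context with $\square$ left open. All multi-hole contexts used in transitions are closed. States: term states $(\Phi,\Gamma,t)$ ($t$ closed) and environment states $(\Phi,\Gamma)$. Relaxed LTS: if $t\to t'$ then $(\Phi,\Gamma,t)\xrightarrow{\tau}(\Phi,\Gamma,t')$; if $\Gamma_i=\lambda x.t$ then $(\Phi,\Gamma)\xrightarrow{\lambda,i,\mathbb{V}}(\Phi,\Gamma,t\{\mathbb{V}[\Phi;\Gamma]/x\})$; $(\Phi,\Gamma,v)\xrightarrow{\downarrow}(\Phi,(\Gamma,v))$; if $t$ is stuck and $\mathbb{F}[t;\Phi;\Gamma]\hookrightarrow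 t'$ then $(\Phi,\Gamma,t)\xrightarrow{\mathbb{F}}(\Phi,\Gamma,t')$; $(\Phi,\Gamma)\xrightarrow{\square,j,\mathbb{V}}(\Phi,\Gamma,\Phi_j[\mathbb{V}[\Phi;\Gamma]])$; if $\Phi_j$ is pure then $(\Phi,\Gamma)\xrightarrow{pure,j}(\Phi,\Gamma)$; if $\Phi_j=F[\langle E\rangle]$ with $E$ pure then $(\Phi,\Gamma)\xrightarrow{split,j}((\Phi,F[\langle\square\rangle],\langle E\rangle),\Gamma)$. Original LTS, on pure states $(\Phi,\Gamma,p)$ with $p ::= v\mid\langle t\rangle$ and environment states, where an evaluation context is delimited if it is of the form $\langle F'\rangle$: if $p\to p'$ then $(\Phi,\Gamma,p)\xrightarrow{\tau}(\Phi,\Gamma,p')$; if $\Gamma_i=\lambda x.t$ and $\mathbb{F}[\Phi;\Gamma]$ is delimited then $(\Phi,\Gamma)\xrightarrow{\lambda,i,\mathbb{V},\mathbb{F}}(\Phi,\Gamma,\mathbb{F}[t\{\mathbb{V}[\Phi;\Gamma]/x\};\Phi;\Gamma])$; $(\Phi,\Gamma,v)\xrightarrow{\downarrow}(\Phi,(\Gamma,v))$; if $\mathbb{F}[\Phi;\Gamma]$ is delimited then $(\Phi,\Gamma)\xrightarrow{\square,j,\mathbb{V},\mathbb{F}}(\Phi,\Gamma,\mathbb{F}[\Phi_j[\mathbb{V}[\Phi;\Gamma]];\Phi;\Gamma])$; and the $pure,j$ and $split,j$ transitions as in the relaxed LTS. For each LTS: $\overset{\tau}{\Rightarrow}$ is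 the reflexive-transitive closure of $\xrightarrow{\tau}$ and $\overset{\alpha}{\Rightarrow}=\overset{\tau}{\Rightarrow}\xrightarrow{\alpha}\overset{\tau}{\Rightarrow}$ for $\alpha\neq\tau$. A bisimulation is a relation $R$ on states such that whenever $s\,R\,s'$ and $s\xrightarrow{\alpha}s_1$ there is $s_1'$ with $s'\overset{\alpha}{\Rightarrow}s_1'$ and $s_1\,R\,s_1'$, and symmetrically. $\approx_{env}$ is the largest bisimulation for the relaxed LTS; $\approx_{env}^p$ the largest for the original LTS. For arbitrary closed terms, $(\emptyset,\emptyset,t_0)\approx_{env}^p(\emptyset,\emptyset,t_1)$ means: for every closed pure context $E$, $(\emptyset,\emptyset,\langle E[t_0]\rangle)\approx_{env}^p(\emptyset,\emptyset,\langle E[t_1]\rangle)$. -}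

module Defs where

open import Level using (Level) renaming (suc to lsuc)
open import Data.Nat using (ℕ; zero; suc)
open import Data.Fin using (Fin; zero; suc)
open import Data.List using (List; []; _∷_; _++_)
open import Data.Maybe using (Maybe; just; nothing; _>>=_) renaming (map to mapMaybe)
open import Data.Product using (Σ; ∃; ∃-syntax; _×_; _,_)
open import Data.Sum using (_⊎_)
open import Data.Empty using (⊥)
open import Relation.Nullary using (¬_)
open import Relation.Binary.PropositionalEquality using (_≡_; _≢_)
open import Relation.Binary.Construct.Closure.ReflexiveTransitive using (Star)
open import Function using (_⇔_)

data Val (n : ℕ) : Set
data Tm  (n : ℕ) : Set

data Val n where
  var : Fin n → Val n
  lam : Tm (suc n) → Val n

data Tm n where
  val   : Val n → Tm n
  app   : Tm n → Tm n → Tm n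
  shift : Tm (suc n) → Tm n
  reset : Tm n → Tm n

Ren : ℕ → ℕ → Set
Ren n m = Fin n → Fin m

ext : ∀ {n m} → Ren n m → Ren (suc n) (suc m)
ext ρ zero    = zero
ext ρ (suc i) = suc (ρ i)

renV : ∀ {n m} → Ren n m → Val n → Val m
renT : ∀ {n m} → Ren n m → Tm n → Tm m
renV ρ (var x) = var (ρ x)
renV ρ (lam t) = lam (renT (ext ρ) t)
renT ρ (val v)   = val (renV ρ v)
renT ρ (app t u) = app (renT ρ t) (renT ρ u)
renT ρ (shift t) = shift (renT (ext ρ) t)
renT ρ (reset t) = reset (renT ρ t)

Sub : ℕ → ℕ → Set
Sub n m = Fin n → Val m

exts : ∀ {n m} → Sub n m → Sub (suc n) (suc m)
exts σ zero    = var zero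
exts σ (suc i) = renV suc (σ i)

subV : ∀ {n m} → Sub n m → Val n → Val m
subT : ∀ {n m} → Sub n m → Tm n → Tm m
subV σ (var x) = σ x
subV σ (lam t) = lam (subT (exts σ) t)
subT σ (val v)   = val (subV σ v)
subT σ (app t u) = app (subT σ t) (subT σ u)
subT σ (shift t) = shift (subT (exts σ) t)
subT σ (reset t) = reset (subT σ t)

single : ∀ {n} → Val n → Sub (suc n) n
single v zero    = v
single v (suc i) = var i

_[_] : ∀ {n} → Tm (suc n) → Val n → Tm n
t [ v ] = subT (single v) t

data ECtx (n : ℕ) : Set where
  hole  : ECtx n
  appR  : Val n → ECtx n → ECtx n
  appL  : ECtx n → Tm n → ECtx n
  rst   : ECtx n → ECtx n

data PureE {n : ℕ} : ECtx n → Set where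
  hole : PureE hole
  appR : ∀ {v E} → PureE E → PureE (appR v E)
  appL : ∀ {E t} → PureE E → PureE (appL E t)

plug : ∀ {n} → ECtx n → Tm n → Tm n
plug hole       t = t
plug (appR v F) t = app (val v) (plug F t)
plug (appL F u) t = app (plug F t) u
plug (rst F)    t = reset (plug F t)

compE : ∀ {n} → ECtx n → ECtx n → ECtx n
compE hole       G = G
compE (appR v F) G = appR v (compE F G)
compE (appL F u) G = appL (compE F G) u
compE (rst F)    G = rst (compE F G)

renE : ∀ {n m} → Ren n m → ECtx n → ECtx m
renE ρ hole       = hole
renE ρ (appR v F) = appR (renV ρ v) (renE ρ F)
renE ρ (appL F u) = appL (renE ρ F) (renT ρ u)
renE ρ (rst F)    = rst (renE ρ F)

Delimited : ∀ {n} → ECtx n → Set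
Delimited {n} F = ∃[ F' ] F ≡ rst {n} F'

data _⟶_ {n : ℕ} : Tm n → Tm n → Set where
  βv     : (F : ECtx n) (t : Tm (suc n)) (v : Val n) →
           plug F (app (val (lam t)) (val v)) ⟶ plug F (t [ v ])
  shiftR : (F E : ECtx n) → PureE E → (t : Tm (suc n)) →
           plug F (reset (plug E (shift t)))
             ⟶ plug F (reset (t [ lam (reset (plug (renE suc E) (val (var zero)))) ]))
  resetR : (F : ECtx n) (v : Val n) →
           plug F (reset (val v)) ⟶ plug F (val v)

_⟶*_ : ∀ {n} → Tm n → Tm n → Set
_⟶*_ = Star _⟶_

IsValue : ∀ {n} → Tm n → Set
IsValue {n} t = ∃[ v ] t ≡ val {n} v

Stuck : ∀ {n} → Tm n → Set
Stuck t = ¬ IsValue t × (∀ t' → ¬ (t ⟶ t'))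

ControlStuck : ∀ {n} → Tm n → Set
ControlStuck {n} t = Σ (ECtx n) λ E → Σ (Tm (suc n)) λ s → PureE E × t ≡ plug E (shift s)

NormalForm : ∀ {n} → Tm n → Set
NormalForm t = IsValue t ⊎ Stuck t

_⇓_ : ∀ {n} → Tm n → Tm n → Set
t ⇓ t' = t ⟶* t' × NormalForm t'

_↪_ : ∀ {n} → Tm n → Tm n → Set
s ↪ s' = (s ⟶ s') ⊎ (NormalForm s × s' ≡ s)

EvalsToValue : Tm 0 → Set
EvalsToValue t = ∃[ t' ] (t ⇓ t' × IsValue t')

EvalsToControlStuck : Tm 0 → Set
EvalsToControlStuck t = ∃[ t' ] (t ⇓ t' × ControlStuck t')

data Ctx (n : ℕ) : ℕ → Set where
  hole   : Ctx n n
  lamC   : ∀ {m} → Ctx (suc n) m → Ctx n m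
  appRC  : ∀ {m} → Tm n → Ctx n m → Ctx n m
  appLC  : ∀ {m} → Ctx n m → Tm n → Ctx n m
  shiftC : ∀ {m} → Ctx (suc n) m → Ctx n m
  resetC : ∀ {m} → Ctx n m → Ctx n m

plugC : ∀ {n m} → Ctx n m → Tm m → Tm n
plugC hole         t = t
plugC (lamC C)     t = val (lam (plugC C t))
plugC (appRC u C)  t = app u (plugC C t)
plugC (appLC C u)  t = app (plugC C t) u
plugC (shiftC C)   t = shift (plugC C t)
plugC (resetC C)   t = reset (plugC C t)

ren0 : ∀ {m} → Ren 0 m
ren0 ()

wkT0 : ∀ {m} → Tm 0 → Tm m
wkT0 = renT ren0

wkV0 : ∀ {m} → Val 0 → Val m
wkV0 = renV ren0

wkE0 : ∀ {m} → ECtx 0 → ECtx m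
wkE0 = renE ren0

_⟦_⟧ : ∀ {m} → Ctx 0 m → Tm 0 → Tm 0
C ⟦ t ⟧ = plugC C (wkT0 t)

_≅_ : Tm 0 → Tm 0 → Set
t₀ ≅ t₁ = ∀ m (C : Ctx 0 m) →
  (EvalsToValue (C ⟦ t₀ ⟧) ⇔ EvalsToValue (C ⟦ t₁ ⟧)) ×
  (EvalsToControlStuck (C ⟦ t₀ ⟧) ⇔ EvalsToControlStuck (C ⟦ t₁ ⟧))

_≅p_ : Tm 0 → Tm 0 → Set
t₀ ≅p t₁ = ∀ m (C : Ctx 0 m) →
  EvalsToValue (reset (C ⟦ t₀ ⟧)) ⇔ EvalsToValue (reset (C ⟦ t₁ ⟧))

-- Multi-hole contexts (indices are 0-based natural numbers)
-- ℂ ::= 𝕍 | ℂ ℂ | ⟨ℂ⟩ | S k.ℂ | ■_j[ℂ]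
-- 𝕍 ::= x | λx.ℂ | □_i
-- 𝔽 ::= □ | 𝔽 ℂ | 𝕍 𝔽 | ⟨𝔽⟩ | ■_j[𝔽]

data MV (n : ℕ) : Set
data MC (n : ℕ) : Set

data MV n where
  mvar  : Fin n → MV n
  mlam  : MC (suc n) → MV n
  mhole : ℕ → MV n

data MC n where
  mval   : MV n → MC n
  mapp   : MC n → MC n → MC n
  mreset : MC n → MC n
  mshift : MC (suc n) → MC n
  mblk   : ℕ → MC n → MC n

data MF (n : ℕ) : Set where
  fhole  : MF n
  fappL  : MF n → MC n → MF n
  fappR  : MV n → MF n → MF n
  freset : MF n → MF n
  fblk   : ℕ → MF n → MF n

_!!_ : ∀ {A : Set} → List A → ℕ → Maybe A
[]       !! _     = nothing
(x ∷ xs) !! zero  = just x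
(x ∷ xs) !! suc i = xs !! i

-- Filling; the result is `nothing` exactly when some index is out of range.
module _ (Φ : List (ECtx 0)) (Γ : List (Val 0)) where

  fillV : ∀ {n} → MV n → Maybe (Val n)
  fillC : ∀ {n} → MC n → Maybe (Tm n)
  fillV (mvar x)  = just (var x)
  fillV (mlam c)  = mapMaybe lam (fillC c)
  fillV (mhole i) = mapMaybe wkV0 (Γ !! i)
  fillC (mval v)     = mapMaybe val (fillV v)
  fillC (mapp a b)   = fillC a >>= λ a' → mapMaybe (app a') (fillC b)
  fillC (mreset c)   = mapMaybe reset (fillC c)
  fillC (mshift c)   = mapMaybe shift (fillC c)
  fillC (mblk j c)   = Φ !! j >>= λ E → mapMaybe (plug (wkE0 E)) (fillC c)

  fillF : ∀ {n} → MF n → Maybe (ECtx n)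
  fillF fhole       = just hole
  fillF (fappL F c) = fillF F >>= λ F' → mapMaybe (appL F') (fillC c)
  fillF (fappR v F) = fillV v >>= λ v' → mapMaybe (appR v') (fillF F)
  fillF (freset F)  = mapMaybe rst (fillF F)
  fillF (fblk j F)  = Φ !! j >>= λ E → mapMaybe (compE (wkE0 E)) (fillF F)

data State : Set where
  term : List (ECtx 0) → List (Val 0) → Tm 0 → State
  env  : List (ECtx 0) → List (Val 0) → State

module Bisimilarity {L : Set} (τ : L) (_—[_]→_ : State → L → State → Set) where

  _⇒τ_ : State → State → Set
  _⇒τ_ = Star (λ s s' → s —[ τ ]→ s')

  Weak : State → L → State → Set
  Weak s α s' = (α ≡ τ × s ⇒τ s') ⊎
    (∃[ s₁ ] ∃[ s₂ ] (s ⇒τ s₁ × s₁ —[ α ]→ s₂ × s₂ ⇒τ s'))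

  IsBisimulation : (State → State → Set) → Set
  IsBisimulation R =
    (∀ {s s' s₁ α} → R s s' → s —[ α ]→ s₁ → ∃[ s₁' ] (Weak s' α s₁' × R s₁ s₁')) ×
    (∀ {s s' s₁' α} → R s s' → s' —[ α ]→ s₁' → ∃[ s₁ ] (Weak s α s₁ × R s₁ s₁'))

  Bisimilar : State → State → Set₁
  Bisimilar s s' = ∃[ R ] (IsBisimulation R × R s s')

data RLabel : Set where
  τ      : RLabel
  lamL   : ℕ → MV 0 → RLabel
  down   : RLabel
  ctxL   : MF 0 → RLabel
  holeL  : ℕ → MV 0 → RLabel
  pureL  : ℕ → RLabel
  splitL : ℕ → RLabel

data _—[_]→ʳ_ : State → RLabel → State → Set where
  tau   : ∀ {Φ Γ t t'} → t ⟶ t' → term Φ Γ t —[ τ ]→ʳ term Φ Γ t'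
  lamT  : ∀ {Φ Γ i V t v} → Γ !! i ≡ just (lam t) → fillV Φ Γ V ≡ just v →
          env Φ Γ —[ lamL i V ]→ʳ term Φ Γ (t [ v ])
  downT : ∀ {Φ Γ v} → term Φ Γ (val v) —[ down ]→ʳ env Φ (Γ ++ v ∷ [])
  ctxT  : ∀ {Φ Γ t 𝔽 F t'} → Stuck t → fillF Φ Γ 𝔽 ≡ just F → plug F t ↪ t' →
          term Φ Γ t —[ ctxL 𝔽 ]→ʳ term Φ Γ t'
  holeT : ∀ {Φ Γ j V E v} → Φ !! j ≡ just E → fillV Φ Γ V ≡ just v →
          env Φ Γ —[ holeL j V ]→ʳ term Φ Γ (plug E (val v))
  pureT : ∀ {Φ Γ j E} → Φ !! j ≡ just E → PureE E →
          env Φ Γ —[ pureL j ]→ʳ env Φ Γ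
  splitT : ∀ {Φ Γ j F E} → Φ !! j ≡ just (compE F (rst E)) → PureE E →
          env Φ Γ —[ splitL j ]→ʳ env (Φ ++ compE F (rst hole) ∷ rst E ∷ []) Γ

module Relaxed = Bisimilarity τ _—[_]→ʳ_

_≈env_ : State → State → Set₁
_≈env_ = Relaxed.Bisimilar

-- Original LTS (on pure states (Φ,Γ,p), p ::= v | ⟨t⟩, and environment states)

PureTerm : Tm 0 → Set
PureTerm p = IsValue p ⊎ (∃[ t ] p ≡ reset t)

data OLabel : Set where
  τ      : OLabel
  lamL   : ℕ → MV 0 → MF 0 → OLabel
  down   : OLabel
  holeL  : ℕ → MV 0 → MF 0 → OLabel
  pureL  : ℕ → OLabel
  splitL : ℕ → OLabel

data _—[_]→ᵒ_ : State → OLabel → State → Set where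
  tau   : ∀ {Φ Γ p p'} → PureTerm p → p ⟶ p' → term Φ Γ p —[ τ ]→ᵒ term Φ Γ p'
  lamT  : ∀ {Φ Γ i V 𝔽 t v F} → Γ !! i ≡ just (lam t) → fillV Φ Γ V ≡ just v →
          fillF Φ Γ 𝔽 ≡ just F → Delimited F →
          env Φ Γ —[ lamL i V 𝔽 ]→ᵒ term Φ Γ (plug F (t [ v ]))
  downT : ∀ {Φ Γ v} → term Φ Γ (val v) —[ down ]→ᵒ env Φ (Γ ++ v ∷ [])
  holeT : ∀ {Φ Γ j V 𝔽 E v F} → Φ !! j ≡ just E → fillV Φ Γ V ≡ just v →
          fillF Φ Γ 𝔽 ≡ just F → Delimited F →
          env Φ Γ —[ holeL j V 𝔽 ]→ᵒ term Φ Γ (plug F (plug E (val v)))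
  pureT : ∀ {Φ Γ j E} → Φ !! j ≡ just E → PureE E →
          env Φ Γ —[ pureL j ]→ᵒ env Φ Γ
  splitT : ∀ {Φ Γ j F E} → Φ !! j ≡ just (compE F (rst E)) → PureE E →
          env Φ Γ —[ splitL j ]→ᵒ env (Φ ++ compE F (rst hole) ∷ rst E ∷ []) Γ

module Original = Bisimilarity τ _—[_]→ᵒ_

_≈envp_ : State → State → Set₁
_≈envp_ = Original.Bisimilar

-- (∅,∅,t₀) ≈ᵖ_env (∅,∅,t₁) for arbitrary closed terms
_≈envpTm_ : Tm 0 → Tm 0 → Set₁
t₀ ≈envpTm t₁ = (E : ECtx 0) → PureE E →
  term [] [] (reset (plug E t₀)) ≈envp term [] [] (reset (plug E t₁))

{-# OPTIONS --safe #-}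
module Submission where

-- No transition from (∅, ∅, t) ever adds to Φ, so only environments Γ of values matter.
--
-- Soundness.  By induction on the length of an evaluation, terms built by the same multi-hole
-- context from bisimilar environments run in lockstep: a call to an entry of Γ is answered by a
-- λ-transition, a returned value by ↓, and a stuck term by the 𝔽-transition for the surrounding
-- evaluation context.  This yields equivalence under closed evaluation contexts; a second induction
-- of the same shape extends it to all contexts, because a hole reaching evaluation position can be
-- exchanged, inside a closed evaluation context, on one side only.
--
-- Completeness.  States with the same observations under all evaluation contexts over Γ form a
-- bisimulation, since every transition is itself such a test followed by deterministic reduction.
--
-- The original LTS is the same argument with an extra reset around everything observed.

open import Defs
open import Data.Empty using (⊥; ⊥-elim)
open import Data.Fin using (Fin; zero; suc)
open import Data.List using (List; []; _∷_; _++_; length)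
open import Data.Maybe using (Maybe; just; _>>=_) renaming (map to mapMaybe)
open import Data.Nat using (ℕ; zero; suc; pred; _≤_; _<_)
open import Data.Nat.Induction using (<-rec)
open import Data.Nat.Properties using (≤-refl; m≤n⇒m≤1+n)
open import Data.Product using (Σ; _×_; _,_; ∃-syntax; proj₁; proj₂)
open import Data.Sum using (_⊎_; inj₁; inj₂)
open import Data.Unit using (⊤; tt)
open import Function using (_⇔_; mk⇔; flip; Equivalence)
open import Relation.Binary.Construct.Closure.ReflexiveTransitive using (ε; _◅_; _◅◅_; gmap)
open import Relation.Binary.PropositionalEquality using (_≡_; refl; sym; trans; cong; cong₂; subst; subst₂)

-- Renaming and substitution

ext-id : ∀ {n} {ρ : Ren n n} → (∀ x → ρ x ≡ x) → ∀ x → ext ρ x ≡ x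
ext-id h zero    = refl
ext-id h (suc x) = cong suc (h x)

renV-id : ∀ {n} {ρ : Ren n n} → (∀ x → ρ x ≡ x) → ∀ v → renV ρ v ≡ v
renT-id : ∀ {n} {ρ : Ren n n} → (∀ x → ρ x ≡ x) → ∀ t → renT ρ t ≡ t
renV-id h (var x)   = cong var (h x)
renV-id h (lam t)   = cong lam (renT-id (ext-id h) t)
renT-id h (val v)   = cong val (renV-id h v)
renT-id h (app t u) = cong₂ app (renT-id h t) (renT-id h u)
renT-id h (shift t) = cong shift (renT-id (ext-id h) t)
renT-id h (reset t) = cong reset (renT-id h t)

ext-∘ : ∀ {n m k} {ρ₁ : Ren n m} {ρ₂ : Ren m k} {ρ₃ : Ren n k} →
        (∀ x → ρ₂ (ρ₁ x) ≡ ρ₃ x) → ∀ x → ext ρ₂ (ext ρ₁ x) ≡ ext ρ₃ x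
ext-∘ h zero    = refl
ext-∘ h (suc x) = cong suc (h x)

renV-∘ : ∀ {n m k} {ρ₁ : Ren n m} {ρ₂ : Ren m k} {ρ₃ : Ren n k} →
         (∀ x → ρ₂ (ρ₁ x) ≡ ρ₃ x) → ∀ v → renV ρ₂ (renV ρ₁ v) ≡ renV ρ₃ v
renT-∘ : ∀ {n m k} {ρ₁ : Ren n m} {ρ₂ : Ren m k} {ρ₃ : Ren n k} →
         (∀ x → ρ₂ (ρ₁ x) ≡ ρ₃ x) → ∀ t → renT ρ₂ (renT ρ₁ t) ≡ renT ρ₃ t
renV-∘ h (var x)   = cong var (h x)
renV-∘ h (lam t)   = cong lam (renT-∘ (ext-∘ h) t)
renT-∘ h (val v)   = cong val (renV-∘ h v)
renT-∘ h (app t u) = cong₂ app (renT-∘ h t) (renT-∘ h u)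
renT-∘ h (shift t) = cong shift (renT-∘ (ext-∘ h) t)
renT-∘ h (reset t) = cong reset (renT-∘ h t)

exts-ext : ∀ {n m k} {ρ : Ren n m} {σ : Sub m k} {ρ′ : Ren n k} →
           (∀ x → σ (ρ x) ≡ var (ρ′ x)) → ∀ x → exts σ (ext ρ x) ≡ var (ext ρ′ x)
exts-ext h zero    = refl
exts-ext h (suc x) = cong (renV suc) (h x)

subV-renV : ∀ {n m k} {ρ : Ren n m} {σ : Sub m k} {ρ′ : Ren n k} →
            (∀ x → σ (ρ x) ≡ var (ρ′ x)) → ∀ v → subV σ (renV ρ v) ≡ renV ρ′ v
subT-renT : ∀ {n m k} {ρ : Ren n m} {σ : Sub m k} {ρ′ : Ren n k} →
            (∀ x → σ (ρ x) ≡ var (ρ′ x)) → ∀ t → subT σ (renT ρ t) ≡ renT ρ′ t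
subV-renV h (var x)   = h x
subV-renV h (lam t)   = cong lam (subT-renT (exts-ext h) t)
subT-renT h (val v)   = cong val (subV-renV h v)
subT-renT h (app t u) = cong₂ app (subT-renT h t) (subT-renT h u)
subT-renT h (shift t) = cong shift (subT-renT (exts-ext h) t)
subT-renT h (reset t) = cong reset (subT-renT h t)

wkV0-closed : ∀ v → wkV0 {0} v ≡ v
wkV0-closed = renV-id λ ()

wkT0-closed : ∀ t → wkT0 {0} t ≡ t
wkT0-closed = renT-id λ ()

renV-wkV0 : ∀ {n m} (ρ : Ren n m) v → renV ρ (wkV0 v) ≡ wkV0 v
renV-wkV0 ρ = renV-∘ λ ()

renT-wkT0 : ∀ {n m} (ρ : Ren n m) t → renT ρ (wkT0 t) ≡ wkT0 t
renT-wkT0 ρ = renT-∘ λ ()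

subV-wkV0 : ∀ {n m} (σ : Sub n m) v → subV σ (wkV0 v) ≡ wkV0 v
subV-wkV0 σ = subV-renV λ ()

subT-wkT0 : ∀ {n m} (σ : Sub n m) t → subT σ (wkT0 t) ≡ wkT0 t
subT-wkT0 σ = subT-renT λ ()

-- Reduction of closed terms

plug-comp : ∀ {n} (F G : ECtx n) t → plug (compE F G) t ≡ plug F (plug G t)
plug-comp hole       G t = refl
plug-comp (appR v F) G t = cong (app (val v)) (plug-comp F G t)
plug-comp (appL F u) G t = cong (λ z → app z u) (plug-comp F G t)
plug-comp (rst F)    G t = cong reset (plug-comp F G t)

⟶-plug : ∀ {n} (F : ECtx n) {t t′} → t ⟶ t′ → plug F t ⟶ plug F t′
⟶-plug F (βv G t v)       = subst₂ _⟶_ (plug-comp F G _) (plug-comp F G _) (βv (compE F G) t v)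
⟶-plug F (shiftR G E p t) = subst₂ _⟶_ (plug-comp F G _) (plug-comp F G _) (shiftR (compE F G) E p t)
⟶-plug F (resetR G v)     = subst₂ _⟶_ (plug-comp F G _) (plug-comp F G _) (resetR (compE F G) v)

⟶*-plug : ∀ {n} (F : ECtx n) {t t′} → t ⟶* t′ → plug F t ⟶* plug F t′
⟶*-plug F = gmap (plug F) (⟶-plug F)

captured : ∀ {n} → ECtx n → Val n
captured E = lam (reset (plug (renE suc E) (val (var zero))))

-- `step` is a function, so determinism of `⟶` needs no argument about unique decompositions: every
-- reduction agrees with the computed outcome.
data Outcome : Set where
  value : Val 0 → Outcome
  stuck : ECtx 0 → Tm 1 → Outcome
  red   : Tm 0 → Outcome

step-reset : Outcome → Outcome
step-reset (value v)   = red (val v)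
step-reset (stuck E b) = red (reset (b [ captured E ]))
step-reset (red t)     = red (reset t)

step-appR : Val 0 → Outcome → Outcome
step-appR (lam t) (value w)   = red (t [ w ])
step-appR v       (stuck E b) = stuck (appR v E) b
step-appR v       (red u)     = red (app (val v) u)

step-app : Outcome → Tm 0 → Outcome → Outcome
step-app (value v)   u o = step-appR v o
step-app (stuck E b) u o = stuck (appL E u) b
step-app (red t)     u o = red (app t u)

step : Tm 0 → Outcome
step (val v)   = value v
step (app t u) = step-app (step t) u (step u)
step (shift t) = stuck hole t
step (reset t) = step-reset (step t)

step-stuck : ∀ {E} → PureE E → ∀ b → step (plug E (shift b)) ≡ stuck E b
step-stuck hole b = refl
-- A closed value is a `lam`; exposing it lets `step-appR`, which splits on the value first,
-- compute.
step-stuck (appR {v = lam _} p) b = cong (step-appR _) (step-stuck p b)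
step-stuck (appL {t = u} p) b = cong (λ o → step-app o u (step u)) (step-stuck p b)

step-plug : ∀ F {t t′} → step t ≡ red t′ → step (plug F t) ≡ red (plug F t′)
step-plug hole e = e
step-plug (appR (lam _) F) e = cong (step-appR _) (step-plug F e)
step-plug (appL F u) e = cong (λ o → step-app o u (step u)) (step-plug F e)
step-plug (rst F) e = cong step-reset (step-plug F e)

⟶⇒step : ∀ {t t′} → t ⟶ t′ → step t ≡ red t′
⟶⇒step (βv F t v)       = step-plug F refl
⟶⇒step (shiftR F E p t) = step-plug F (cong step-reset (step-stuck p t))
⟶⇒step (resetR F v)     = step-plug F refl

⟶-deterministic : {t t₁ t₂ : Tm 0} → t ⟶ t₁ → t ⟶ t₂ → t₁ ≡ t₂
⟶-deterministic r₁ r₂ with trans (sym (⟶⇒step r₁)) (⟶⇒step r₂)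
... | refl = refl

-- In a closed term no variable can be applied, so a shift under a pure context is the only stuck
-- shape. Unlike `Outcome`, the view carries the reduction itself.
data View : Tm 0 → Set where
  value : ∀ v → View (val v)
  stuck : ∀ {E} → PureE E → ∀ b → View (plug E (shift b))
  red   : ∀ {t t′} → t ⟶ t′ → View t

view : ∀ t → View t
view (val v)   = value v
view (shift t) = stuck hole t
view (reset t) with view t
... | value v   = red (resetR hole v)
... | stuck p b = red (shiftR hole _ p b)
... | red r     = red (⟶-plug (rst hole) r)
view (app t u) with view t
... | stuck p b = stuck (appL p) b
... | red r     = red (⟶-plug (appL hole u) r)
... | value (lam b) with view u
...   | value w   = red (βv hole b w)
...   | stuck p c = stuck (appR p) c
...   | red r     = red (⟶-plug (appR (lam b) hole) r)

-- A reset at the root either stays there or disappears around a value. The original LTS has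
-- τ-transitions from pure terms only, so its runs must remain pure.
⟶-preserves-pure : ∀ {p p′} → PureTerm p → p ⟶ p′ → PureTerm p′
⟶-preserves-pure (inj₁ (v , refl)) r with ⟶⇒step r
... | ()
⟶-preserves-pure (inj₂ (t , refl)) r with view t
... | value v   rewrite ⟶-deterministic r (resetR hole v) = inj₁ (v , refl)
... | stuck q b rewrite ⟶-deterministic r (shiftR hole _ q b) = inj₂ (_ , refl)
... | red r′    rewrite ⟶-deterministic r (⟶-plug (rst hole) r′) = inj₂ (_ , refl)

pure-reduct : ∀ t → ∃[ t′ ] (reset t ⟶ t′)
pure-reduct t with view t
... | value v   = _ , resetR hole v
... | stuck q b = _ , shiftR hole _ q b
... | red r     = _ , ⟶-plug (rst hole) r

-- Observations

data Kind : Set where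
  isValue isStuck : Kind

Is : Kind → Tm 0 → Set
Is isValue = IsValue
Is isStuck = ControlStuck

Is-irreducible : ∀ κ {t t′} → Is κ t → t ⟶ t′ → ⊥
Is-irreducible isValue (v , refl) r with ⟶⇒step r
... | ()
Is-irreducible isStuck (E , b , p , refl) r with trans (sym (step-stuck p b)) (⟶⇒step r)
... | ()

Stuck⇒ControlStuck : ∀ {t} → Stuck t → ControlStuck t
Stuck⇒ControlStuck {t} (nv , nr) with view t
... | value v   = ⊥-elim (nv (v , refl))
... | stuck p b = _ , b , p , refl
... | red r     = ⊥-elim (nr _ r)

ControlStuck⇒¬IsValue : ∀ {t} → ControlStuck t → IsValue t → ⊥
ControlStuck⇒¬IsValue (E , b , p , e) (v , refl) with trans (cong step e) (step-stuck p b)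
... | ()

ControlStuck⇒Stuck : ∀ {t} → ControlStuck t → Stuck t
ControlStuck⇒Stuck cs = ControlStuck⇒¬IsValue cs , λ _ → Is-irreducible isStuck cs

Is⇒NormalForm : ∀ κ {t} → Is κ t → NormalForm t
Is⇒NormalForm isValue i = inj₁ i
Is⇒NormalForm isStuck i = inj₂ (ControlStuck⇒Stuck i)

↪-total : ∀ t → ∃[ t′ ] (t ↪ t′)
↪-total t with view t
... | value v   = _ , inj₂ (inj₁ (v , refl) , refl)
... | stuck p b = _ , inj₂ (inj₂ (ControlStuck⇒Stuck (_ , b , p , refl)) , refl)
... | red r     = _ , inj₁ r

↪⇒⟶* : ∀ {t t′ : Tm 0} → t ↪ t′ → t ⟶* t′
↪⇒⟶* (inj₁ r)          = r ◅ ε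
↪⇒⟶* (inj₂ (_ , refl)) = ε

pure⇒¬ControlStuck : ∀ {t} → PureTerm t → ControlStuck t → ⊥
pure⇒¬ControlStuck (inj₁ iv) cs = ControlStuck⇒¬IsValue cs iv
pure⇒¬ControlStuck (inj₂ (t , refl)) cs = Is-irreducible isStuck cs (proj₂ (pure-reduct t))

Obs : Kind → Tm 0 → Set
Obs κ t = ∃[ t′ ] (t ⟶* t′ × Is κ t′)

EvalsTo : Kind → Tm 0 → Set
EvalsTo κ t = ∃[ t′ ] (t ⇓ t′ × Is κ t′)

Obs⇒EvalsTo : ∀ κ {t} → Obs κ t → EvalsTo κ t
Obs⇒EvalsTo κ (t′ , rs , i) = t′ , (rs , Is⇒NormalForm κ i) , i

EvalsTo⇒Obs : ∀ κ {t} → EvalsTo κ t → Obs κ t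
EvalsTo⇒Obs κ (t′ , (rs , _) , i) = t′ , rs , i

Obs-expand : ∀ κ {t t′} → t ⟶* t′ → Obs κ t′ → Obs κ t
Obs-expand κ rs (u , rs′ , i) = u , rs ◅◅ rs′ , i

-- By determinism an evaluation passes through every reduct. Together with `Obs-expand` this makes
-- observations invariant under reduction.
Obs-reduce : ∀ κ {t t′} → t ⟶* t′ → Obs κ t → Obs κ t′
Obs-reduce κ ε o = o
Obs-reduce κ (r ◅ rs) (u , ε , i) = ⊥-elim (Is-irreducible κ i r)
Obs-reduce κ (r ◅ rs) (u , r′ ◅ rs′ , i) rewrite ⟶-deterministic r r′ = Obs-reduce κ rs (u , rs′ , i)

-- Purity is preserved by reduction, and a pure term is never control-stuck.
¬Obs-stuck-reset : ∀ {t} → Obs isStuck (reset t) → ⊥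
¬Obs-stuck-reset (u , rs , cs) = go (inj₂ (_ , refl)) rs cs
  where
  go : ∀ {p u} → PureTerm p → p ⟶* u → ControlStuck u → ⊥
  go pp ε cs        = pure⇒¬ControlStuck pp cs
  go pp (r ◅ rs) cs = go (⟶-preserves-pure pp r) rs cs

-- The step count is the measure for the inductions on evaluations.
data Ev (κ : Kind) : ℕ → Tm 0 → Set where
  done : ∀ {t} → Is κ t → Ev κ zero t
  next : ∀ {k t t′} → t ⟶ t′ → Ev κ k t′ → Ev κ (suc k) t

Obs⇒Ev : ∀ κ {t} → Obs κ t → ∃[ k ] Ev κ k t
Obs⇒Ev κ (u , ε , i)      = zero , done i
Obs⇒Ev κ (u , r ◅ rs , i) with Obs⇒Ev κ (u , rs , i)
... | k , e = suc k , next r e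

Ev⇒Obs : ∀ {κ k t} → Ev κ k t → Obs κ t
Ev⇒Obs (done i) = _ , ε , i
Ev⇒Obs (next r e) with Ev⇒Obs e
... | u , rs , i = u , r ◅ rs , i

Ev-reduce : ∀ {κ k t t′} → t ⟶ t′ → Ev κ k t → ∃[ j ] (k ≡ suc j × Ev κ j t′)
Ev-reduce {κ} r (done i) = ⊥-elim (Is-irreducible κ i r)
Ev-reduce r (next r′ e) rewrite ⟶-deterministic r r′ = _ , refl , e

-- Compatible closures

-- A derivation is a multi-hole context together with its two fillings. Value holes stand for
-- environment entries, term holes for the two programs under comparison.
data Congᵛ (Hᵛ : Val 0 → Val 0 → Set) (Hᵗ : Tm 0 → Tm 0 → Set) {n : ℕ} : Val n → Val n → Set
data Congᵗ (Hᵛ : Val 0 → Val 0 → Set) (Hᵗ : Tm 0 → Tm 0 → Set) {n : ℕ} : Tm n → Tm n → Set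

-- The weakenings in ~hole are kept as equations so that derivations can be matched on.
data Congᵛ Hᵛ Hᵗ {n} where
  ~var  : ∀ x → Congᵛ Hᵛ Hᵗ (var x) (var x)
  ~lam  : ∀ {t s} → Congᵗ Hᵛ Hᵗ t s → Congᵛ Hᵛ Hᵗ (lam t) (lam s)
  ~hole : ∀ {v w v′ w′} → Hᵛ v w → v′ ≡ wkV0 v → w′ ≡ wkV0 w → Congᵛ Hᵛ Hᵗ v′ w′

data Congᵗ Hᵛ Hᵗ {n} where
  ~val   : ∀ {v w} → Congᵛ Hᵛ Hᵗ v w → Congᵗ Hᵛ Hᵗ (val v) (val w)
  ~app   : ∀ {t s t′ s′} → Congᵗ Hᵛ Hᵗ t s → Congᵗ Hᵛ Hᵗ t′ s′ → Congᵗ Hᵛ Hᵗ (app t t′) (app s s′)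
  ~shift : ∀ {t s} → Congᵗ Hᵛ Hᵗ t s → Congᵗ Hᵛ Hᵗ (shift t) (shift s)
  ~reset : ∀ {t s} → Congᵗ Hᵛ Hᵗ t s → Congᵗ Hᵛ Hᵗ (reset t) (reset s)
  ~hole  : ∀ {t s t′ s′} → Hᵗ t s → t′ ≡ wkT0 t → s′ ≡ wkT0 s → Congᵗ Hᵛ Hᵗ t′ s′

data Congᵉ (Hᵛ : Val 0 → Val 0 → Set) (Hᵗ : Tm 0 → Tm 0 → Set) {n : ℕ} : ECtx n → ECtx n → Set where
  ~□    : Congᵉ Hᵛ Hᵗ hole hole
  ~appR : ∀ {v w F G} → Congᵛ Hᵛ Hᵗ v w → Congᵉ Hᵛ Hᵗ F G → Congᵉ Hᵛ Hᵗ (appR v F) (appR w G)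
  ~appL : ∀ {t s F G} → Congᵉ Hᵛ Hᵗ F G → Congᵗ Hᵛ Hᵗ t s → Congᵉ Hᵛ Hᵗ (appL F t) (appL G s)
  ~rst  : ∀ {F G} → Congᵉ Hᵛ Hᵗ F G → Congᵉ Hᵛ Hᵗ (rst F) (rst G)

module _ {Hᵛ : Val 0 → Val 0 → Set} {Hᵗ : Tm 0 → Tm 0 → Set} where

  Congᵛ-refl : ∀ {n} (v : Val n) → Congᵛ Hᵛ Hᵗ v v
  Congᵗ-refl : ∀ {n} (t : Tm n) → Congᵗ Hᵛ Hᵗ t t
  Congᵛ-refl (var x)   = ~var x
  Congᵛ-refl (lam t)   = ~lam (Congᵗ-refl t)
  Congᵗ-refl (val v)   = ~val (Congᵛ-refl v)
  Congᵗ-refl (app t u) = ~app (Congᵗ-refl t) (Congᵗ-refl u)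
  Congᵗ-refl (shift t) = ~shift (Congᵗ-refl t)
  Congᵗ-refl (reset t) = ~reset (Congᵗ-refl t)

  Congᵉ-refl : ∀ {n} (F : ECtx n) → Congᵉ Hᵛ Hᵗ F F
  Congᵉ-refl hole       = ~□
  Congᵉ-refl (appR v F) = ~appR (Congᵛ-refl v) (Congᵉ-refl F)
  Congᵉ-refl (appL F u) = ~appL (Congᵉ-refl F) (Congᵗ-refl u)
  Congᵉ-refl (rst F)    = ~rst (Congᵉ-refl F)

  Congᵛ-ren : ∀ {n m} (ρ : Ren n m) {v w} → Congᵛ Hᵛ Hᵗ v w → Congᵛ Hᵛ Hᵗ (renV ρ v) (renV ρ w)
  Congᵗ-ren : ∀ {n m} (ρ : Ren n m) {t s} → Congᵗ Hᵛ Hᵗ t s → Congᵗ Hᵛ Hᵗ (renT ρ t) (renT ρ s)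
  Congᵛ-ren ρ (~var x)            = ~var (ρ x)
  Congᵛ-ren ρ (~lam d)            = ~lam (Congᵗ-ren (ext ρ) d)
  Congᵛ-ren ρ (~hole h refl refl) = ~hole h (renV-wkV0 ρ _) (renV-wkV0 ρ _)
  Congᵗ-ren ρ (~val d)            = ~val (Congᵛ-ren ρ d)
  Congᵗ-ren ρ (~app d d′)         = ~app (Congᵗ-ren ρ d) (Congᵗ-ren ρ d′)
  Congᵗ-ren ρ (~shift d)          = ~shift (Congᵗ-ren (ext ρ) d)
  Congᵗ-ren ρ (~reset d)          = ~reset (Congᵗ-ren ρ d)
  Congᵗ-ren ρ (~hole h refl refl) = ~hole h (renT-wkT0 ρ _) (renT-wkT0 ρ _)

  Congᵉ-ren : ∀ {n m} (ρ : Ren n m) {F G} → Congᵉ Hᵛ Hᵗ F G → Congᵉ Hᵛ Hᵗ (renE ρ F) (renE ρ G)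
  Congᵉ-ren ρ ~□          = ~□
  Congᵉ-ren ρ (~appR d D) = ~appR (Congᵛ-ren ρ d) (Congᵉ-ren ρ D)
  Congᵉ-ren ρ (~appL D d) = ~appL (Congᵉ-ren ρ D) (Congᵗ-ren ρ d)
  Congᵉ-ren ρ (~rst D)    = ~rst (Congᵉ-ren ρ D)

  Congˢ : ∀ {n m} → Sub n m → Sub n m → Set
  Congˢ σ σ′ = ∀ x → Congᵛ Hᵛ Hᵗ (σ x) (σ′ x)

  Congˢ-exts : ∀ {n m} {σ σ′ : Sub n m} → Congˢ σ σ′ → Congˢ (exts σ) (exts σ′)
  Congˢ-exts h zero    = ~var zero
  Congˢ-exts h (suc x) = Congᵛ-ren suc (h x)

  -- Hole fillings are closed, so substitution leaves them alone. This keeps the reducts of related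
  -- terms inside the closure.
  Congᵛ-sub : ∀ {n m} {σ σ′ : Sub n m} → Congˢ σ σ′ → ∀ {v w} →
              Congᵛ Hᵛ Hᵗ v w → Congᵛ Hᵛ Hᵗ (subV σ v) (subV σ′ w)
  Congᵗ-sub : ∀ {n m} {σ σ′ : Sub n m} → Congˢ σ σ′ → ∀ {t s} →
              Congᵗ Hᵛ Hᵗ t s → Congᵗ Hᵛ Hᵗ (subT σ t) (subT σ′ s)
  Congᵛ-sub hσ (~var x)            = hσ x
  Congᵛ-sub hσ (~lam d)            = ~lam (Congᵗ-sub (Congˢ-exts hσ) d)
  Congᵛ-sub hσ (~hole h refl refl) = ~hole h (subV-wkV0 _ _) (subV-wkV0 _ _)
  Congᵗ-sub hσ (~val d)            = ~val (Congᵛ-sub hσ d)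
  Congᵗ-sub hσ (~app d d′)         = ~app (Congᵗ-sub hσ d) (Congᵗ-sub hσ d′)
  Congᵗ-sub hσ (~shift d)          = ~shift (Congᵗ-sub (Congˢ-exts hσ) d)
  Congᵗ-sub hσ (~reset d)          = ~reset (Congᵗ-sub hσ d)
  Congᵗ-sub hσ (~hole h refl refl) = ~hole h (subT-wkT0 _ _) (subT-wkT0 _ _)

  Congᵗ-[] : ∀ {n} {t s : Tm (suc n)} {v w} → Congᵗ Hᵛ Hᵗ t s → Congᵛ Hᵛ Hᵗ v w →
             Congᵗ Hᵛ Hᵗ (t [ v ]) (s [ w ])
  Congᵗ-[] d d′ = Congᵗ-sub (λ { zero → d′ ; (suc x) → ~var x }) d

  Congᵗ-plug : ∀ {n} {F G : ECtx n} {t s} → Congᵉ Hᵛ Hᵗ F G → Congᵗ Hᵛ Hᵗ t s →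
               Congᵗ Hᵛ Hᵗ (plug F t) (plug G s)
  Congᵗ-plug ~□ d           = d
  Congᵗ-plug (~appR e D) d  = ~app (~val e) (Congᵗ-plug D d)
  Congᵗ-plug (~appL D e) d  = ~app (Congᵗ-plug D d) e
  Congᵗ-plug (~rst D) d     = ~reset (Congᵗ-plug D d)

  Congᵉ-comp : ∀ {n} {F G F′ G′ : ECtx n} → Congᵉ Hᵛ Hᵗ F G → Congᵉ Hᵛ Hᵗ F′ G′ →
               Congᵉ Hᵛ Hᵗ (compE F F′) (compE G G′)
  Congᵉ-comp ~□ D′          = D′
  Congᵉ-comp (~appR e D) D′ = ~appR e (Congᵉ-comp D D′)
  Congᵉ-comp (~appL D e) D′ = ~appL (Congᵉ-comp D D′) e
  Congᵉ-comp (~rst D) D′    = ~rst (Congᵉ-comp D D′)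

  Congᵉ-pure : ∀ {n} {E E′ : ECtx n} → Congᵉ Hᵛ Hᵗ E E′ → PureE E → PureE E′
  Congᵉ-pure ~□ hole              = hole
  Congᵉ-pure (~appR _ D) (appR p) = appR (Congᵉ-pure D p)
  Congᵉ-pure (~appL D _) (appL p) = appL (Congᵉ-pure D p)

  Congᵛ-captured : ∀ {n} {E E′ : ECtx n} → Congᵉ Hᵛ Hᵗ E E′ → Congᵛ Hᵛ Hᵗ (captured E) (captured E′)
  Congᵛ-captured D = ~lam (~reset (Congᵗ-plug (Congᵉ-ren suc D) (~val (~var zero))))

module _ {Hᵛ Hᵛ′ : Val 0 → Val 0 → Set} {Hᵗ : Tm 0 → Tm 0 → Set} (f : ∀ {v w} → Hᵛ v w → Hᵛ′ v w) where

  Congᵛ-mono : ∀ {n} {v w : Val n} → Congᵛ Hᵛ Hᵗ v w → Congᵛ Hᵛ′ Hᵗ v w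
  Congᵗ-mono : ∀ {n} {t s : Tm n} → Congᵗ Hᵛ Hᵗ t s → Congᵗ Hᵛ′ Hᵗ t s
  Congᵛ-mono (~var x)        = ~var x
  Congᵛ-mono (~lam d)        = ~lam (Congᵗ-mono d)
  Congᵛ-mono (~hole h e e′)  = ~hole (f h) e e′
  Congᵗ-mono (~val d)        = ~val (Congᵛ-mono d)
  Congᵗ-mono (~app d d′)     = ~app (Congᵗ-mono d) (Congᵗ-mono d′)
  Congᵗ-mono (~shift d)      = ~shift (Congᵗ-mono d)
  Congᵗ-mono (~reset d)      = ~reset (Congᵗ-mono d)
  Congᵗ-mono (~hole h e e′)  = ~hole h e e′

  Congᵉ-mono : ∀ {n} {F G : ECtx n} → Congᵉ Hᵛ Hᵗ F G → Congᵉ Hᵛ′ Hᵗ F G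
  Congᵉ-mono ~□          = ~□
  Congᵉ-mono (~appR d D) = ~appR (Congᵛ-mono d) (Congᵉ-mono D)
  Congᵉ-mono (~appL D d) = ~appL (Congᵉ-mono D) (Congᵗ-mono d)
  Congᵉ-mono (~rst D)    = ~rst (Congᵉ-mono D)

-- Running related terms in lockstep

-- `bare` serves the relaxed LTS and `≅`; `delimited` adds the outer reset of `≅p`.
data Mode : Set where
  bare delimited : Mode

top : Mode → ECtx 0
top bare      = hole
top delimited = rst hole

module _ (Hᵛ : Val 0 → Val 0 → Set) (Hᵗ : Tm 0 → Tm 0 → Set) where

  -- `calls` is the one case in which the shared context does not determine the next step: the
  -- operators are arbitrary related values, whose bodies need not have a common shape.
  data Lockstep : Tm 0 → Tm 0 → Set where
    values : ∀ {v w} → Congᵛ Hᵛ Hᵗ v w → Lockstep (val v) (val w)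
    stucks : ∀ {E E′ b b′} → PureE E → Congᵉ Hᵛ Hᵗ E E′ → Congᵗ Hᵛ Hᵗ b b′ →
             Lockstep (plug E (shift b)) (plug E′ (shift b′))
    steps  : ∀ {t s t′ s′} → t ⟶ t′ → s ⟶ s′ → Congᵗ Hᵛ Hᵗ t′ s′ → Lockstep t s
    calls  : ∀ {F G v w v′ w′} → Congᵉ Hᵛ Hᵗ F G → Hᵛ v w → Congᵛ Hᵛ Hᵗ v′ w′ →
             Lockstep (plug F (app (val v) (val v′))) (plug G (app (val w) (val w′)))

module _ (κ : Kind) (m : Mode) where

  _⊑_ : Tm 0 → Tm 0 → Set
  t ⊑ s = ∀ F → Obs κ (plug (top m) (plug F t)) → Obs κ (plug (top m) (plug F s))

  ⊑-plug : ∀ G {t s} → t ⊑ s → plug G t ⊑ plug G s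
  ⊑-plug G h F o = subst (λ z → Obs κ (plug (top m) z)) (plug-comp F G _)
    (h (compE F G) (subst (λ z → Obs κ (plug (top m) z)) (sym (plug-comp F G _)) o))

  ⊑-trans : ∀ {t s u} → t ⊑ s → s ⊑ u → t ⊑ u
  ⊑-trans h h′ F o = h′ F (h F o)

module _ {Hᵛ : Val 0 → Val 0 → Set} {Hᵗ : Tm 0 → Tm 0 → Set} (κ : Kind) (m : Mode) where

  private
    infix 4 _≲_
    _≲_ = _⊑_ κ m
    under = ⊑-plug κ m

  -- A pair of holes (t , s) in evaluation position is replaced by (t , t), which s dominates,
  -- so that only literal terms are ever run.
  lockstep : (∀ {t s} → Hᵗ t s → t ≲ s) →
             ∀ {t s} → Congᵗ Hᵛ Hᵗ t s → ∃[ s* ] (s* ≲ s × Lockstep Hᵛ Hᵗ t s*)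
  lockstep H (~hole {t} {s} h refl refl) rewrite wkT0-closed t | wkT0-closed s = t , H h , self
    where
    self : Lockstep Hᵛ Hᵗ t t
    self with view t
    ... | value v   = values (Congᵛ-refl v)
    ... | stuck p b = stucks p (Congᵉ-refl _) (Congᵗ-refl b)
    ... | red r     = steps r r (Congᵗ-refl _)
  lockstep H (~val d)   = _ , (λ F o → o) , values d
  lockstep H (~shift d) = _ , (λ F o → o) , stucks hole ~□ d
  lockstep H (~reset d) with lockstep H d
  ... | s* , le , values e =
    _ , under (rst hole) le , steps (resetR hole _) (resetR hole _) (~val e)
  ... | s* , le , stucks p D e =
    _ , under (rst hole) le ,
    steps (shiftR hole _ p _) (shiftR hole _ (Congᵉ-pure D p) _) (~reset (Congᵗ-[] e (Congᵛ-captured D)))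
  ... | s* , le , steps r r′ e =
    _ , under (rst hole) le , steps (⟶-plug (rst hole) r) (⟶-plug (rst hole) r′) (~reset e)
  ... | s* , le , calls D h e = _ , under (rst hole) le , calls (~rst D) h e
  lockstep H (~app {s′ = u} d d′) with lockstep H d
  ... | s* , le , stucks p D e = _ , under (appL hole u) le , stucks (appL p) (~appL D d′) e
  ... | s* , le , steps r r′ e =
    _ , under (appL hole u) le ,
    steps (⟶-plug (appL hole _) r) (⟶-plug (appL hole _) r′) (~app e d′)
  ... | s* , le , calls D h e = _ , under (appL hole u) le , calls (~appL D d′) h e
  ... | s* , le , values {w = w} c with lockstep H d′
  ...   | u* , le′ , stucks p D e =
    -- The chain runs through `app (val w) u`: the argument is exchanged next to the value `w`,
    -- since `appR` admits only a value there, and the operator afterwards.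
    _ , ⊑-trans κ m (under (appR w hole) le′) (under (appL hole u) le) , stucks (appR p) (~appR c D) e
  ...   | u* , le′ , steps r r′ e =
    _ , ⊑-trans κ m (under (appR w hole) le′) (under (appL hole u) le) ,
    steps (⟶-plug (appR _ hole) r) (⟶-plug (appR _ hole) r′) (~app (~val c) e)
  ...   | u* , le′ , calls D h e =
    _ , ⊑-trans κ m (under (appR w hole) le′) (under (appL hole u) le) , calls (~appR c D) h e
  ...   | u* , le′ , values e =
    _ , ⊑-trans κ m (under (appR w hole) le′) (under (appL hole u) le) , apply c
    where
    apply : ∀ {v w} → Congᵛ Hᵛ Hᵗ v w → Lockstep Hᵛ Hᵗ (app (val v) (val _)) (app (val w) (val _))
    -- A closed operator is either a λ of the shared context, which both sides contract, or a value
    -- hole, which becomes a call.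
    apply (~lam b) = steps (βv hole _ _) (βv hole _ _) (Congᵗ-[] b e)
    apply (~hole {v} {w} h refl refl) rewrite wkV0-closed v | wkV0-closed w = calls ~□ h e

  Call : ℕ → Set
  Call k = ∀ {F G v w v′ w′} → Congᵉ Hᵛ Hᵗ F G → Hᵛ v w → Congᵛ Hᵛ Hᵗ v′ w′ →
    Ev κ k (plug (top m) (plug F (app (val v) (val v′)))) →
    Obs κ (plug (top m) (plug G (app (val w) (val w′))))

  -- Matching steps lower `k` and stay in the closure; values and stuck terms of the shared context
  -- yield the same observation on both sides. Calls are left to the hypothesis `call`, so that one
  -- lemma serves both LTSs as well as `ciu`.
  run : (∀ {t s} → Hᵗ t s → t ≲ s) → ∀ k → (∀ j → j ≤ k → Call j) →
        ∀ {t s} → Congᵗ Hᵛ Hᵗ t s → Ev κ k (plug (top m) t) → Obs κ (plug (top m) s)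
  run H k call d ev with lockstep H d
  ... | s* , le , dec = le hole (go k m refl call dec ev)
    where
    -- `m′` copies the module parameter `m`, so that the clauses can match on the mode.
    go : ∀ k m′ → m′ ≡ m → (∀ j → j ≤ k → Call j) → ∀ {t s} → Lockstep Hᵛ Hᵗ t s →
         Ev κ k (plug (top m′) t) → Obs κ (plug (top m′) s)
    go k m′ refl call (calls D h e) ev = call k ≤-refl D h e ev
    go k m′ refl call (steps r r′ e) ev with Ev-reduce (⟶-plug (top m′) r) ev
    ... | j , refl , ev′ = Obs-expand κ (⟶-plug (top m′) r′ ◅ ε)
      (run H j (λ i le → call i (m≤n⇒m≤1+n le)) e ev′)
    go k bare eq call (values {v} {w} d) ev = obs κ ev
      where
      obs : ∀ κ → Ev κ k (val v) → Obs κ (val w)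
      obs isValue _ = _ , ε , _ , refl
      obs isStuck (done cs) = ⊥-elim (ControlStuck⇒¬IsValue cs (_ , refl))
      obs isStuck (next r _) = ⊥-elim (Is-irreducible isValue (_ , refl) r)
    go k delimited eq call (values {v} {w} d) ev = obs κ (Ev⇒Obs ev)
      where
      obs : ∀ κ → Obs κ (reset (val v)) → Obs κ (reset (val w))
      obs isValue _ = _ , resetR hole w ◅ ε , _ , refl
      obs isStuck o = ⊥-elim (¬Obs-stuck-reset o)
    go k bare eq call (stucks {E} {E′} {b} {b′} p D e) ev = obs κ (Ev⇒Obs ev)
      where
      obs : ∀ κ → Obs κ (plug E (shift b)) → Obs κ (plug E′ (shift b′))
      obs isStuck _ = _ , ε , E′ , b′ , Congᵉ-pure D p , refl
      obs isValue (_ , ε , iv) = ⊥-elim (ControlStuck⇒¬IsValue (E , b , p , refl) iv)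
      obs isValue (_ , r ◅ _ , _) = ⊥-elim (Is-irreducible isStuck (E , b , p , refl) r)
    -- The reset of `top` delimits the capture and still surrounds the reduct, so `run` continues in
    -- the same mode.
    go k delimited refl call (stucks p D e) ev with Ev-reduce (shiftR hole _ p _) ev
    ... | j , refl , ev′ = Obs-expand κ (shiftR hole _ (Congᵉ-pure D p) _ ◅ ε)
      (run H j (λ i le → call i (m≤n⇒m≤1+n le)) (Congᵗ-[] e (Congᵛ-captured D)) ev′)

-- Environments

data None {A : Set} : A → A → Set where

data Look (Γ Δ : List (Val 0)) (v w : Val 0) : Set where
  at : ∀ i → Γ !! i ≡ just v → Δ !! i ≡ just w → Look Γ Δ v w

!!-++ˡ : ∀ {A : Set} (xs : List A) {ys i x} → xs !! i ≡ just x → (xs ++ ys) !! i ≡ just x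
!!-++ˡ (x ∷ xs) {i = zero}  e = e
!!-++ˡ (x ∷ xs) {i = suc i} e = !!-++ˡ xs e

!!-last : ∀ {A : Set} (xs : List A) {x} → (xs ++ x ∷ []) !! length xs ≡ just x
!!-last []       = refl
!!-last (_ ∷ xs) = !!-last xs

!!-length : ∀ {A : Set} (xs ys : List A) → length xs ≡ length ys →
            ∀ i {x} → xs !! i ≡ just x → ∃[ y ] (ys !! i ≡ just y)
!!-length (x ∷ xs) (y ∷ ys) l zero    e = y , refl
!!-length (x ∷ xs) (y ∷ ys) l (suc i) e = !!-length xs ys (cong pred l) i e

length-snoc : ∀ (Γ Δ : List (Val 0)) {v w} → length Γ ≡ length Δ →
              length (Γ ++ v ∷ []) ≡ length (Δ ++ w ∷ [])
length-snoc []      []      l = refl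
length-snoc (_ ∷ Γ) (_ ∷ Δ) l = cong suc (length-snoc Γ Δ (cong pred l))

Look-snoc : ∀ Γ Δ {v w v′ w′} → Look Γ Δ v w → Look (Γ ++ v′ ∷ []) (Δ ++ w′ ∷ []) v w
Look-snoc Γ Δ (at i p q) = at i (!!-++ˡ Γ p) (!!-++ˡ Δ q)

Look-last : ∀ Γ Δ {v w} → length Γ ≡ length Δ → Look (Γ ++ v ∷ []) (Δ ++ w ∷ []) v w
Look-last Γ Δ l = at (length Γ) (!!-last Γ) (subst (λ i → (Δ ++ _ ∷ []) !! i ≡ just _) (sym l) (!!-last Δ))

Look-snoc⁻ : ∀ Γ Δ {v w v′ w′} → length Γ ≡ length Δ → Look (Γ ++ v′ ∷ []) (Δ ++ w′ ∷ []) v w →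
             Look Γ Δ v w ⊎ (v ≡ v′ × w ≡ w′)
Look-snoc⁻ []      []      l (at zero refl refl) = inj₂ (refl , refl)
Look-snoc⁻ (_ ∷ Γ) (_ ∷ Δ) l (at zero p q) = inj₁ (at zero p q)
Look-snoc⁻ (_ ∷ Γ) (_ ∷ Δ) l (at (suc i) p q) with Look-snoc⁻ Γ Δ (cong pred l) (at i p q)
... | inj₁ (at j p′ q′) = inj₁ (at (suc j) p′ q′)
... | inj₂ e            = inj₂ e

module _ (Γ Δ : List (Val 0)) where

  Envᵛ : ∀ {n} → Val n → Val n → Set
  Envᵛ = Congᵛ (Look Γ Δ) None

  Envᵗ : ∀ {n} → Tm n → Tm n → Set
  Envᵗ = Congᵗ (Look Γ Δ) None

  Envᵉ : ∀ {n} → ECtx n → ECtx n → Set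
  Envᵉ = Congᵉ (Look Γ Δ) None

module _ {Γ Δ : List (Val 0)} where

  -- Transition labels are multi-hole contexts; reading a derivation as such a context yields a
  -- label that both states can fill.
  Envᵛ-fill : ∀ {n} {v w : Val n} → Envᵛ Γ Δ v w → ∃[ V ] (fillV [] Γ V ≡ just v × fillV [] Δ V ≡ just w)
  Envᵗ-fill : ∀ {n} {t s : Tm n} → Envᵗ Γ Δ t s → ∃[ C ] (fillC [] Γ C ≡ just t × fillC [] Δ C ≡ just s)
  Envᵛ-fill (~var x) = mvar x , refl , refl
  Envᵛ-fill (~lam d) with Envᵗ-fill d
  ... | C , p , q = mlam C , cong (mapMaybe lam) p , cong (mapMaybe lam) q
  Envᵛ-fill (~hole (at i p q) refl refl) = mhole i , cong (mapMaybe wkV0) p , cong (mapMaybe wkV0) q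
  Envᵗ-fill (~val d) with Envᵛ-fill d
  ... | V , p , q = mval V , cong (mapMaybe val) p , cong (mapMaybe val) q
  Envᵗ-fill (~app d d′) with Envᵗ-fill d | Envᵗ-fill d′
  ... | C , p , q | C′ , p′ , q′ = mapp C C′ , cong₂ bind p p′ , cong₂ bind q q′
    where bind = λ a b → a >>= λ a′ → mapMaybe (app a′) b
  Envᵗ-fill (~shift d) with Envᵗ-fill d
  ... | C , p , q = mshift C , cong (mapMaybe shift) p , cong (mapMaybe shift) q
  Envᵗ-fill (~reset d) with Envᵗ-fill d
  ... | C , p , q = mreset C , cong (mapMaybe reset) p , cong (mapMaybe reset) q

  Envᵉ-fill : ∀ {n} {F G : ECtx n} → Envᵉ Γ Δ F G → ∃[ 𝔽 ] (fillF [] Γ 𝔽 ≡ just F × fillF [] Δ 𝔽 ≡ just G)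
  Envᵉ-fill ~□ = fhole , refl , refl
  Envᵉ-fill (~appR d D) with Envᵛ-fill d | Envᵉ-fill D
  ... | V , p , q | 𝔽 , p′ , q′ = fappR V 𝔽 , cong₂ bind p p′ , cong₂ bind q q′
    where bind = λ a b → a >>= λ a′ → mapMaybe (appR a′) b
  Envᵉ-fill (~appL D d) with Envᵉ-fill D | Envᵗ-fill d
  ... | 𝔽 , p , q | C , p′ , q′ = fappL 𝔽 C , cong₂ bind p p′ , cong₂ bind q q′
    where bind = λ a b → a >>= λ a′ → mapMaybe (appL a′) b
  Envᵉ-fill (~rst D) with Envᵉ-fill D
  ... | 𝔽 , p , q = freset 𝔽 , cong (mapMaybe rst) p , cong (mapMaybe rst) q

  module _ (l : length Γ ≡ length Δ) where

    -- Equal lengths make an index valid on one side valid on the other. The case `mblk` is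
    -- impossible: over the empty Φ its filling is `nothing`.
    fillV-Env : ∀ {n} (V : MV n) {v} → fillV [] Γ V ≡ just v → ∃[ w ] (fillV [] Δ V ≡ just w × Envᵛ Γ Δ v w)
    fillC-Env : ∀ {n} (C : MC n) {t} → fillC [] Γ C ≡ just t → ∃[ s ] (fillC [] Δ C ≡ just s × Envᵗ Γ Δ t s)
    fillV-Env (mvar x) refl = _ , refl , ~var x
    fillV-Env (mlam C) e with fillC [] Γ C in p
    fillV-Env (mlam C) refl | just t with fillC-Env C p
    ... | s , q , d rewrite q = _ , refl , ~lam d
    fillV-Env (mhole i) e with Γ !! i in p
    fillV-Env (mhole i) refl | just v with !!-length Γ Δ l i p
    ... | w , q rewrite q = _ , refl , ~hole (at i p q) refl refl
    fillC-Env (mval V) e with fillV [] Γ V in p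
    fillC-Env (mval V) refl | just v with fillV-Env V p
    ... | w , q , d rewrite q = _ , refl , ~val d
    fillC-Env (mapp C C′) e with fillC [] Γ C in p | fillC [] Γ C′ in p′
    fillC-Env (mapp C C′) refl | just _ | just _ with fillC-Env C p | fillC-Env C′ p′
    ... | _ , q , d | _ , q′ , d′ rewrite q | q′ = _ , refl , ~app d d′
    fillC-Env (mreset C) e with fillC [] Γ C in p
    fillC-Env (mreset C) refl | just t with fillC-Env C p
    ... | s , q , d rewrite q = _ , refl , ~reset d
    fillC-Env (mshift C) e with fillC [] Γ C in p
    fillC-Env (mshift C) refl | just t with fillC-Env C p
    ... | s , q , d rewrite q = _ , refl , ~shift d

    fillF-Env : ∀ {n} (𝔽 : MF n) {F} → fillF [] Γ 𝔽 ≡ just F → ∃[ G ] (fillF [] Δ 𝔽 ≡ just G × Envᵉ Γ Δ F G)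
    fillF-Env fhole refl = _ , refl , ~□
    fillF-Env (fappL 𝔽 C) e with fillF [] Γ 𝔽 in p | fillC [] Γ C in p′
    fillF-Env (fappL 𝔽 C) refl | just _ | just _ with fillF-Env 𝔽 p | fillC-Env C p′
    ... | _ , q , d | _ , q′ , d′ rewrite q | q′ = _ , refl , ~appL d d′
    fillF-Env (fappR V 𝔽) e with fillV [] Γ V in p | fillF [] Γ 𝔽 in p′
    fillF-Env (fappR V 𝔽) refl | just _ | just _ with fillV-Env V p | fillF-Env 𝔽 p′
    ... | _ , q , d | _ , q′ , d′ rewrite q | q′ = _ , refl , ~appR d d′
    fillF-Env (freset 𝔽) e with fillF [] Γ 𝔽 in p
    fillF-Env (freset 𝔽) refl | just _ with fillF-Env 𝔽 p
    ... | _ , q , d rewrite q = _ , refl , ~rst d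

just-functional : ∀ {A : Set} {m : Maybe A} {x y} → m ≡ just x → m ≡ just y → x ≡ y
just-functional refl refl = refl

-- Closed evaluation contexts suffice to test closed terms

data Only {A : Set} (x y : A) : A → A → Set where
  only : Only x y x y

Congᵗ-plugC : ∀ {n m t s} (C : Ctx n m) → Congᵗ None (Only t s) (plugC C (wkT0 t)) (plugC C (wkT0 s))
Congᵗ-plugC hole        = ~hole only refl refl
Congᵗ-plugC (lamC C)    = ~val (~lam (Congᵗ-plugC C))
Congᵗ-plugC (appRC u C) = ~app (Congᵗ-refl u) (Congᵗ-plugC C)
Congᵗ-plugC (appLC C u) = ~app (Congᵗ-plugC C) (Congᵗ-refl u)
Congᵗ-plugC (shiftC C)  = ~shift (Congᵗ-plugC C)
Congᵗ-plugC (resetC C)  = ~reset (Congᵗ-plugC C)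

-- Value holes range over `None`, so no call can occur, and `run` asks only that `s` dominate `t`
-- under closed evaluation contexts.
ciu : ∀ κ m {t s} → _⊑_ κ m t s → ∀ {n} (C : Ctx 0 n) →
      Obs κ (plug (top m) (C ⟦ t ⟧)) → Obs κ (plug (top m) (C ⟦ s ⟧))
ciu κ m le C o with Obs⇒Ev κ o
... | k , ev = run κ m (λ { only → le }) k (λ _ _ _ ()) (Congᵗ-plugC C) ev

toCtx : ∀ {n} → ECtx n → Ctx n n
toCtx hole       = hole
toCtx (appR v F) = appRC (val v) (toCtx F)
toCtx (appL F u) = appLC (toCtx F) u
toCtx (rst F)    = resetC (toCtx F)

plugC-toCtx : ∀ {n} (F : ECtx n) t → plugC (toCtx F) t ≡ plug F t
plugC-toCtx hole       t = refl
plugC-toCtx (appR v F) t = cong (app (val v)) (plugC-toCtx F t)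
plugC-toCtx (appL F u) t = cong (λ z → app z u) (plugC-toCtx F t)
plugC-toCtx (rst F)    t = cong reset (plugC-toCtx F t)

toCtx-⟦⟧ : ∀ F t → toCtx F ⟦ t ⟧ ≡ plug F t
toCtx-⟦⟧ F t = trans (plugC-toCtx F (wkT0 t)) (cong (plug F) (wkT0-closed t))

-- Soundness of the relaxed bisimilarity

module RelaxedTransitions where

  open Relaxed

  τ*-term : ∀ {Φ Γ t X} → term Φ Γ t ⇒τ X → ∃[ t′ ] (t ⟶* t′ × X ≡ term Φ Γ t′)
  τ*-term ε = _ , ε , refl
  τ*-term (tau r ◅ rs) with τ*-term rs
  ... | t′ , rs′ , e = t′ , r ◅ rs′ , e

  τ*-env : ∀ {Φ Γ X} → env Φ Γ ⇒τ X → X ≡ env Φ Γ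
  τ*-env ε = refl
  τ*-env (() ◅ _)

  τ*-lift : ∀ {Φ Γ t t′} → t ⟶* t′ → term Φ Γ t ⇒τ term Φ Γ t′
  τ*-lift = gmap (term _ _) tau

  weak-τ : ∀ {Φ Γ t X} → Weak (term Φ Γ t) τ X → ∃[ t′ ] (t ⟶* t′ × X ≡ term Φ Γ t′)
  weak-τ (inj₁ (_ , rs)) = τ*-term rs
  weak-τ (inj₂ (_ , _ , rs , r , rs′)) = τ*-term (rs ◅◅ r ◅ rs′)

  weak-down : ∀ {Φ Γ t X} → Weak (term Φ Γ t) down X → ∃[ v ] (t ⟶* val v × X ≡ env Φ (Γ ++ v ∷ []))
  weak-down (inj₁ (() , _))
  weak-down (inj₂ (_ , _ , rs , r , rs′)) with τ*-term rs
  weak-down (inj₂ (_ , _ , rs , downT , rs′)) | _ , rs″ , refl = _ , rs″ , τ*-env rs′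

  weak-lam : ∀ {Φ Γ i V X} → Weak (env Φ Γ) (lamL i V) X →
             ∃[ b ] ∃[ v ] ∃[ t ] (Γ !! i ≡ just (lam b) × fillV Φ Γ V ≡ just v ×
                                   (b [ v ]) ⟶* t × X ≡ term Φ Γ t)
  weak-lam (inj₁ (() , _))
  weak-lam (inj₂ (_ , _ , rs , r , rs′)) with τ*-env rs
  weak-lam (inj₂ (_ , _ , rs , lamT p q , rs′)) | refl with τ*-term rs′
  ... | t , rs″ , e = _ , _ , t , p , q , rs″ , e

  weak-ctx : ∀ {Φ Γ t 𝔽 X} → Weak (term Φ Γ t) (ctxL 𝔽) X →
             ∃[ u ] ∃[ F ] ∃[ t′ ] (t ⟶* u × Stuck u × fillF Φ Γ 𝔽 ≡ just F × plug F u ⟶* t′ × X ≡ term Φ Γ t′)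
  weak-ctx (inj₁ (() , _))
  weak-ctx (inj₂ (_ , _ , rs , r , rs′)) with τ*-term rs
  weak-ctx (inj₂ (_ , _ , rs , ctxT st p q , rs′)) | u , rs″ , refl with τ*-term rs′
  ... | t′ , rs‴ , e = u , _ , t′ , rs″ , st , p , ↪⇒⟶* q ◅◅ rs‴ , e

-- Only one simulation clause is assumed; the converse implication between programs comes from the
-- same module at the flipped relation.
module RelaxedSoundness (R : State → State → Set)
  (sim : ∀ {s s′ s₁ α} → R s s′ → s —[ α ]→ʳ s₁ → ∃[ s₁′ ] (Relaxed.Weak s′ α s₁′ × R s₁ s₁′))
  (κ : Kind) where

  open RelaxedTransitions

  Claim : ℕ → Set
  Claim k = ∀ {Γ Δ t s F G} → length Γ ≡ length Δ → R (term [] Γ t) (term [] Δ s) →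
            Envᵉ Γ Δ F G → Ev κ k (plug F t) → Obs κ (plug G s)

  -- The β-step of the call is paid from the count, so the bodies, related by the λ-transition, fall
  -- under the induction hypothesis.
  call : ∀ {Γ Δ} k → (∀ {j} → j < k → Claim j) → length Γ ≡ length Δ → R (env [] Γ) (env [] Δ) →
         ∀ j → j ≤ k → Call {Look Γ Δ} {None} κ bare j
  call k ih l r j j≤k {F} {G} {lam b} D (at i p q) e ev
    with Ev-reduce (⟶-plug F (βv hole b _)) ev
  ... | j′ , refl , ev′ with Envᵛ-fill e
  ... | V , p′ , q′ with sim r (lamT {V = V} p p′)
  ... | X , w , r′ with weak-lam w
  ... | b′ , v′ , s , q₁ , q₂ , rs , refl
    rewrite just-functional q q₁ | just-functional q′ q₂ =
    -- With `j` matched as `suc j′`, the proof `j≤k` is itself `j′ < k`.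
    Obs-expand κ (⟶*-plug G (βv hole b′ v′ ◅ rs)) (ih j≤k l r′ D ev′)

  -- A `ctxL` transition starts only from a stuck term, so answering the one with the empty context
  -- forces `s` to reach such a term.
  stuck-match : ∀ {Γ Δ t s} → R (term [] Γ t) (term [] Δ s) → ControlStuck t → Obs isStuck s
  stuck-match r cs
    with sim r (ctxT {𝔽 = fhole} (ControlStuck⇒Stuck cs) refl (inj₂ (Is⇒NormalForm isStuck cs , refl)))
  ... | X , w , r′ with weak-ctx w
  ... | u , F , s′ , rs , st , _ = u , rs , Stuck⇒ControlStuck st

  normal-match : ∀ {Γ Δ t s} κ → NormalForm t → Obs κ t → R (term [] Γ t) (term [] Δ s) → Obs κ s
  normal-match isStuck (inj₂ st) o r = stuck-match r (Stuck⇒ControlStuck st)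
  normal-match isValue (inj₁ (v , refl)) o r with sim r downT
  ... | X , w , r′ with weak-down w
  ... | v′ , rs , _ = val v′ , rs , v′ , refl
  normal-match isStuck (inj₁ iv) (_ , ε , cs) r = ⊥-elim (ControlStuck⇒¬IsValue cs iv)
  normal-match isStuck (inj₁ iv) (_ , r₁ ◅ _ , _) r = ⊥-elim (Is-irreducible isValue iv r₁)
  normal-match isValue (inj₂ (nv , nr)) (_ , ε , iv) r = ⊥-elim (nv iv)
  normal-match isValue (inj₂ (nv , nr)) (_ , r₁ ◅ _ , _) r = ⊥-elim (nr _ r₁)

  claim : ∀ k → Claim k
  claim = <-rec Claim body
    where
    body : ∀ k → (∀ {j} → j < k → Claim j) → Claim k
    body k ih {Γ} {Δ} {t} {s} {F} {G} l r D ev with view t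
    ... | red r₁ with Ev-reduce (⟶-plug F r₁) ev
    ...   | j , refl , ev′ with sim r (tau r₁)
    ...   | X , w , r′ with weak-τ w
    ...   | s′ , rs , refl = Obs-expand κ (⟶*-plug G rs) (ih ≤-refl l r′ D ev′)
    body k ih {Γ} {Δ} {t} {s} {F} {G} l r D ev | value v with sim r downT
    ... | X , w , r′ with weak-down w
    -- The returned value becomes a new hole, so both programs now come from one context. No step is
    -- spent here: `ih` is used only at calls, whose β-step lowers the count.
    ... | v′ , rs , refl = Obs-expand κ (⟶*-plug G rs)
      (run κ bare (λ ()) k (call k ih (length-snoc Γ Δ l) r′)
        (Congᵗ-plug (Congᵉ-mono (Look-snoc Γ Δ) D)
          (~val (~hole (Look-last Γ Δ l) (sym (wkV0-closed v)) (sym (wkV0-closed v′))))) ev)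
    body k ih {Γ} {Δ} {t} {s} {F} {G} l r D ev | stuck p b
      with ↪-total (plug F t) | Envᵉ-fill D
    ... | t′ , m | 𝔽 , e , e′ with sim r (ctxT {𝔽 = 𝔽} (ControlStuck⇒Stuck (_ , b , p , refl)) e m)
    ... | X , w , r′ with weak-ctx w
    ... | u , G′ , s′ , rs , st , e″ , rs′ , refl rewrite just-functional e′ e″ =
      Obs-expand κ (⟶*-plug G′ rs ◅◅ rs′) (rest m)
      where
      rest : plug F t ↪ t′ → Obs κ s′
      -- The transition has absorbed `F` into the term, so the remaining context is empty. Either
      -- `plug F t` took a counted step, or it is a normal form, whose kind one further transition
      -- reveals.
      rest (inj₁ r₁) with Ev-reduce r₁ ev
      ... | j , refl , ev′ = ih ≤-refl l r′ ~□ ev′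
      rest (inj₂ (nf , refl)) = normal-match κ nf (Ev⇒Obs ev) r′

  sound : ∀ {t s n} (C : Ctx 0 n) → R (term [] [] t) (term [] [] s) → Obs κ (C ⟦ t ⟧) → Obs κ (C ⟦ s ⟧)
  sound C r = ciu κ bare (λ F o → let k , ev = Obs⇒Ev κ o in claim k refl r (Congᵉ-refl F) ev) C

-- Soundness of the original bisimilarity

module OriginalTransitions where

  open Original

  τ*-term : ∀ {Φ Γ t X} → term Φ Γ t ⇒τ X → ∃[ t′ ] (t ⟶* t′ × X ≡ term Φ Γ t′)
  τ*-term ε = _ , ε , refl
  τ*-term (tau _ r ◅ rs) with τ*-term rs
  ... | t′ , rs′ , e = t′ , r ◅ rs′ , e

  τ*-env : ∀ {Φ Γ X} → env Φ Γ ⇒τ X → X ≡ env Φ Γ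
  τ*-env ε = refl
  τ*-env (() ◅ _)

  τ*-lift : ∀ {Φ Γ t t′} → PureTerm t → t ⟶* t′ → term Φ Γ t ⇒τ term Φ Γ t′
  τ*-lift p ε        = ε
  τ*-lift p (r ◅ rs) = tau p r ◅ τ*-lift (⟶-preserves-pure p r) rs

  weak-τ : ∀ {Φ Γ t X} → Weak (term Φ Γ t) τ X → ∃[ t′ ] (t ⟶* t′ × X ≡ term Φ Γ t′)
  weak-τ (inj₁ (_ , rs)) = τ*-term rs
  weak-τ (inj₂ (_ , _ , rs , r , rs′)) = τ*-term (rs ◅◅ r ◅ rs′)

  weak-down : ∀ {Φ Γ t X} → Weak (term Φ Γ t) down X → ∃[ v ] (t ⟶* val v × X ≡ env Φ (Γ ++ v ∷ []))
  weak-down (inj₁ (() , _))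
  weak-down (inj₂ (_ , _ , rs , r , rs′)) with τ*-term rs
  weak-down (inj₂ (_ , _ , rs , downT , rs′)) | _ , rs″ , refl = _ , rs″ , τ*-env rs′

  weak-lam : ∀ {Φ Γ i V 𝔽 X} → Weak (env Φ Γ) (lamL i V 𝔽) X →
             ∃[ b ] ∃[ v ] ∃[ F ] ∃[ t ] (Γ !! i ≡ just (lam b) × fillV Φ Γ V ≡ just v ×
               fillF Φ Γ 𝔽 ≡ just F × plug F (b [ v ]) ⟶* t × X ≡ term Φ Γ t)
  weak-lam (inj₁ (() , _))
  weak-lam (inj₂ (_ , _ , rs , r , rs′)) with τ*-env rs
  weak-lam (inj₂ (_ , _ , rs , lamT p q q′ _ , rs′)) | refl with τ*-term rs′
  ... | t , rs″ , e = _ , _ , _ , t , p , q , q′ , rs″ , e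

module OriginalSoundness (R : State → State → Set)
  (sim : ∀ {s s′ s₁ α} → R s s′ → s —[ α ]→ᵒ s₁ → ∃[ s₁′ ] (Original.Weak s′ α s₁′ × R s₁ s₁′)) where

  open OriginalTransitions

  value-match : ∀ {Γ Δ p q} k → PureTerm p → R (term [] Γ p) (term [] Δ q) → Ev isValue k p → Obs isValue q
  value-match zero pp r (done (v , refl)) with sim r downT
  ... | X , w , r′ with weak-down w
  ... | v′ , rs , _ = val v′ , rs , v′ , refl
  value-match (suc k) pp r (next r₁ ev) with sim r (tau pp r₁)
  ... | X , w , r′ with weak-τ w
  ... | q′ , rs , refl = Obs-expand isValue rs (value-match k (⟶-preserves-pure pp r₁) r′ ev)

  -- The label of an original λ-transition carries the whole delimited context, so its target is the
  -- entire program and `value-match` finishes. Unlike in the relaxed case, there is no mutual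
  -- induction with `claim`.
  call : ∀ {Γ Δ} → R (env [] Γ) (env [] Δ) → ∀ j → Call {Look Γ Δ} {None} isValue delimited j
  call r j {F} {G} {lam b} D (at i p q) e ev
    with Ev-reduce (⟶-plug (rst F) (βv hole b _)) ev
  ... | j′ , refl , ev′ with Envᵛ-fill e | Envᵉ-fill (~rst D)
  ... | V , p′ , q′ | 𝔽 , p″ , q″ with sim r (lamT {V = V} {𝔽 = 𝔽} p p′ p″ (F , refl))
  ... | X , w , r′ with weak-lam w
  ... | b′ , v′ , F′ , s , q₁ , q₂ , q₃ , rs , refl
    rewrite just-functional q q₁ | just-functional q′ q₂ | just-functional q₃ q″ =
    Obs-expand isValue (⟶-plug (rst G) (βv hole b′ v′) ◅ rs) (value-match j′ (inj₂ (_ , refl)) r′ ev′)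

  -- A reset always reduces, so `p` is never stuck: its steps are matched until it returns a value,
  -- which then joins the environment.
  claim : ∀ {Γ Δ p q F G} k → PureTerm p → length Γ ≡ length Δ → R (term [] Γ p) (term [] Δ q) →
          Envᵉ Γ Δ F G → Ev isValue k (reset (plug F p)) → Obs isValue (reset (plug G q))
  claim {Γ} {Δ} k (inj₁ (v , refl)) l r D ev with sim r downT
  ... | X , w , r′ with weak-down w
  ... | v′ , rs , refl = Obs-expand isValue (⟶*-plug (rst _) rs)
    (run isValue delimited (λ ()) k (λ j _ → call r′ j)
      (Congᵗ-plug (Congᵉ-mono (Look-snoc Γ Δ) D)
        (~val (~hole (Look-last Γ Δ l) (sym (wkV0-closed v)) (sym (wkV0-closed v′))))) ev)
  claim {F = F} k (inj₂ (t , refl)) l r D ev with pure-reduct t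
  ... | p′ , r₁ with Ev-reduce (⟶-plug (rst F) r₁) ev
  ... | j , refl , ev′ with sim r (tau (inj₂ (t , refl)) r₁)
  ... | X , w , r′ with weak-τ w
  ... | q′ , rs , refl = Obs-expand isValue (⟶*-plug (rst _) rs)
    (claim j (⟶-preserves-pure (inj₂ (t , refl)) r₁) l r′ D ev′)

-- Cutting at the reset nearest the hole exposes `rst E` with `E` pure, the form for which `≈envpTm`
-- provides related states. For a pure `F`, the outer reset of the test plays that part.
pure-or-split : ∀ {n} (F : ECtx n) → PureE F ⊎ (∃[ G ] ∃[ E ] (PureE E × F ≡ compE G (rst E)))
pure-or-split hole = inj₁ hole
pure-or-split (appR v F) with pure-or-split F
... | inj₁ p                  = inj₁ (appR p)
... | inj₂ (G , E , p , refl) = inj₂ (appR v G , E , p , refl)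
pure-or-split (appL F u) with pure-or-split F
... | inj₁ p                  = inj₁ (appL p)
... | inj₂ (G , E , p , refl) = inj₂ (appL G u , E , p , refl)
pure-or-split (rst F) with pure-or-split F
... | inj₁ p                  = inj₂ (hole , F , p , refl)
... | inj₂ (G , E , p , refl) = inj₂ (rst G , E , p , refl)

OriginalSimilar : State → State → Set₁
OriginalSimilar s s′ = Σ (State → State → Set) λ R →
  ((∀ {s s′ s₁ α} → R s s′ → s —[ α ]→ᵒ s₁ → ∃[ s₁′ ] (Original.Weak s′ α s₁′ × R s₁ s₁′)) × R s s′)

originalSound : ∀ {t s} →
  (∀ E → PureE E → OriginalSimilar (term [] [] (reset (plug E t))) (term [] [] (reset (plug E s)))) →
  ∀ {n} (C : Ctx 0 n) → Obs isValue (reset (C ⟦ t ⟧)) → Obs isValue (reset (C ⟦ s ⟧))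
originalSound {t} {s} h = ciu isValue delimited test
  where
  test : _⊑_ isValue delimited t s
  test F o with pure-or-split F
  ... | inj₁ p with h F p
  ...   | R , sim , r = let k , ev = Obs⇒Ev isValue o in
    OriginalSoundness.value-match R sim k (inj₂ (_ , refl)) r ev
  test F o | inj₂ (G , E , p , refl) with h E p
  ... | R , sim , r rewrite plug-comp G (rst E) t | plug-comp G (rst E) s =
    let k , ev = Obs⇒Ev isValue o in
    OriginalSoundness.claim R sim k (inj₂ (_ , refl)) refl r (Congᵉ-refl G) ev

-- Abstracting an entry of the environment into a variable

module _ {Hᵛ Hᵛ′ : Val 0 → Val 0 → Set} {v w : Val 0}
         (split : ∀ {a b} → Hᵛ′ a b → Hᵛ a b ⊎ (a ≡ v × b ≡ w)) where

  -- Being general in `ι` and `x` lets the invariant pass under binders, where the abstracted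
  -- variable is no longer `zero`.
  record Abstracts {n k : ℕ} (ι : Ren n k) (x : Fin k) (u : Val 0) (σ : Sub k n) : Set where
    constructor abstracts
    field
      old : ∀ y → σ (ι y) ≡ var y
      new : σ x ≡ wkV0 u

  Abstracts-exts : ∀ {n k} {ι : Ren n k} {x u σ} → Abstracts ι x u σ →
                   Abstracts (ext ι) (suc x) u (exts σ)
  Abstracts-exts (abstracts old new) = abstracts
    (λ { zero → refl ; (suc y) → cong (renV suc) (old y) })
    (trans (cong (renV suc) new) (renV-wkV0 suc _))

  -- Substitution read backwards: occurrences of the pair `v`, `w` singled out by `split` become the
  -- variable `x`, while all other entries remain holes.
  abstractᵛ : ∀ {n k} {ι : Ren n k} {x σ σ′} → Abstracts ι x v σ → Abstracts ι x w σ′ →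
              ∀ {a b} → Congᵛ Hᵛ′ None a b →
              ∃[ a° ] ∃[ b° ] (Congᵛ Hᵛ None a° b° × subV σ a° ≡ a × subV σ′ b° ≡ b)
  abstractᵗ : ∀ {n k} {ι : Ren n k} {x σ σ′} → Abstracts ι x v σ → Abstracts ι x w σ′ →
              ∀ {t s} → Congᵗ Hᵛ′ None t s →
              ∃[ t° ] ∃[ s° ] (Congᵗ Hᵛ None t° s° × subT σ t° ≡ t × subT σ′ s° ≡ s)
  abstractᵛ {ι = ι} A A′ (~var y) = var (ι y) , var (ι y) , ~var _ , Abstracts.old A y , Abstracts.old A′ y
  abstractᵛ A A′ (~lam d) with abstractᵗ (Abstracts-exts A) (Abstracts-exts A′) d
  ... | _ , _ , d° , e , e′ = _ , _ , ~lam d° , cong lam e , cong lam e′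
  abstractᵛ {x = x} A A′ (~hole h refl refl) with split h
  ... | inj₁ h°            = _ , _ , ~hole h° refl refl , subV-wkV0 _ _ , subV-wkV0 _ _
  ... | inj₂ (refl , refl) = var x , var x , ~var x , Abstracts.new A , Abstracts.new A′
  abstractᵗ A A′ (~val d) with abstractᵛ A A′ d
  ... | _ , _ , d° , e , e′ = _ , _ , ~val d° , cong val e , cong val e′
  abstractᵗ A A′ (~app d₁ d₂) with abstractᵗ A A′ d₁ | abstractᵗ A A′ d₂
  ... | _ , _ , d₁° , e₁ , e₁′ | _ , _ , d₂° , e₂ , e₂′ =
    _ , _ , ~app d₁° d₂° , cong₂ app e₁ e₂ , cong₂ app e₁′ e₂′
  abstractᵗ A A′ (~shift d) with abstractᵗ (Abstracts-exts A) (Abstracts-exts A′) d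
  ... | _ , _ , d° , e , e′ = _ , _ , ~shift d° , cong shift e , cong shift e′
  abstractᵗ A A′ (~reset d) with abstractᵗ A A′ d
  ... | _ , _ , d° , e , e′ = _ , _ , ~reset d° , cong reset e , cong reset e′

-- Completeness

module Completeness (m : Mode) where

  Leᵗ : List (Val 0) → List (Val 0) → Tm 0 → Tm 0 → Set
  Leᵗ Γ Δ t s = ∀ κ {F G} → Envᵉ Γ Δ F G → Obs κ (plug (top m) (plug F t)) → Obs κ (plug (top m) (plug G s))

  Leᵉ : List (Val 0) → List (Val 0) → Set
  Leᵉ Γ Δ = ∀ κ {t s} → Envᵗ Γ Δ t s → Obs κ (plug (top m) t) → Obs κ (plug (top m) s)

  Leᵗ-reduce : ∀ {Γ Δ t s t′ s′} → t ⟶* t′ → s ⟶* s′ → Leᵗ Γ Δ t s → Leᵗ Γ Δ t′ s′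
  Leᵗ-reduce rs rs′ le κ {F} {G} D o =
    Obs-reduce κ (⟶*-plug (top m) (⟶*-plug G rs′)) (le κ D (Obs-expand κ (⟶*-plug (top m) (⟶*-plug F rs)) o))

  Leᵗ-plug : ∀ {Γ Δ t s F G} → Envᵉ Γ Δ F G → Leᵗ Γ Δ t s → Leᵗ Γ Δ (plug F t) (plug G s)
  Leᵗ-plug {t = t} {s} {F} {G} D le κ {F′} {G′} D′ o
    rewrite sym (plug-comp F′ F t) | sym (plug-comp G′ G s) = le κ (Congᵉ-comp D′ D) o

  Leᵉ⇒Leᵗ : ∀ {Γ Δ t s} → Leᵉ Γ Δ → Envᵗ Γ Δ t s → Leᵗ Γ Δ t s
  Leᵉ⇒Leᵗ le d κ D = le κ (Congᵗ-plug D d)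

  -- Testing (Γ , v) with a term is testing v with the context (λx.t) □, x standing for v.
  Leᵗ⇒Leᵉ : ∀ {Γ Δ v w} → length Γ ≡ length Δ → Leᵗ Γ Δ (val v) (val w) → Leᵉ (Γ ++ v ∷ []) (Δ ++ w ∷ [])
  Leᵗ⇒Leᵉ {Γ} {Δ} {v} {w} l le κ d o
    with abstractᵗ {Hᵛ = Look Γ Δ} (Look-snoc⁻ Γ Δ l) {ι = λ ()} {zero} {single v} {single w}
           (abstracts (λ ()) (sym (wkV0-closed v))) (abstracts (λ ()) (sym (wkV0-closed w))) d
  ... | t° , s° , d° , refl , refl =
    Obs-reduce κ (⟶-plug (top m) (βv hole s° w) ◅ ε)
      (le κ (~appR (~lam d°) ~□) (Obs-expand κ (⟶-plug (top m) (βv hole t° v) ◅ ε) o))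

  -- Applying the two entries is itself a test of the environments, and it reduces to the bodies.
  Leᵉ⇒Leᵗ-call : ∀ {Γ Δ i b b′ v w} → Leᵉ Γ Δ → Γ !! i ≡ just (lam b) → Δ !! i ≡ just (lam b′) →
                 Envᵛ Γ Δ v w → Leᵗ Γ Δ (b [ v ]) (b′ [ w ])
  Leᵉ⇒Leᵗ-call {i = i} le p q d = Leᵗ-reduce (βv hole _ _ ◅ ε) (βv hole _ _ ◅ ε)
    (Leᵉ⇒Leᵗ le (~app (~val (~hole (at i p q) (sym (wkV0-closed _)) (sym (wkV0-closed _)))) (~val d)))

  -- `Good` is the invariant of term states: trivial for the relaxed LTS, `PureTerm` for the
  -- original one.
  data Rel (Good : Tm 0 → Set) : State → State → Set where
    terms : ∀ {Γ Δ t s} → Good t → Good s → length Γ ≡ length Δ → Leᵗ Γ Δ t s → Leᵗ Δ Γ s t →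
            Rel Good (term [] Γ t) (term [] Δ s)
    envs  : ∀ {Γ Δ} → length Γ ≡ length Δ → Leᵉ Γ Δ → Leᵉ Δ Γ → Rel Good (env [] Γ) (env [] Δ)

  Rel-sym : ∀ {Good s s′} → Rel Good s s′ → Rel Good s′ s
  Rel-sym (terms g g′ l le ge) = terms g′ g (sym l) ge le
  Rel-sym (envs l le ge)       = envs (sym l) ge le

  Rel-down : ∀ {Good Γ Δ v t w} → length Γ ≡ length Δ → t ⟶* val w →
             Leᵗ Γ Δ (val v) t → Leᵗ Δ Γ t (val v) → Rel Good (env [] (Γ ++ v ∷ [])) (env [] (Δ ++ w ∷ []))
  Rel-down {Γ = Γ} {Δ} l rs le ge = envs (length-snoc Γ Δ l)
    (Leᵗ⇒Leᵉ l (Leᵗ-reduce ε rs le)) (Leᵗ⇒Leᵉ (sym l) (Leᵗ-reduce rs ε ge))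

-- Without entries a derivation has no holes, so initial states are tested by one and the same
-- context on both sides, as in contextual equivalence.
Env-[]ᵛ : ∀ {n} {v w : Val n} → Envᵛ [] [] v w → v ≡ w
Env-[]ᵗ : ∀ {n} {t s : Tm n} → Envᵗ [] [] t s → t ≡ s
Env-[]ᵛ (~var x)    = refl
Env-[]ᵛ (~lam d)    = cong lam (Env-[]ᵗ d)
Env-[]ᵛ (~hole (at i () _) _ _)
Env-[]ᵗ (~val d)    = cong val (Env-[]ᵛ d)
Env-[]ᵗ (~app d d′) = cong₂ app (Env-[]ᵗ d) (Env-[]ᵗ d′)
Env-[]ᵗ (~shift d)  = cong shift (Env-[]ᵗ d)
Env-[]ᵗ (~reset d)  = cong reset (Env-[]ᵗ d)

Env-[]ᵉ : ∀ {n} {F G : ECtx n} → Envᵉ [] [] F G → F ≡ G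
Env-[]ᵉ ~□          = refl
Env-[]ᵉ (~appR d D) = cong₂ appR (Env-[]ᵛ d) (Env-[]ᵉ D)
Env-[]ᵉ (~appL D d) = cong₂ appL (Env-[]ᵉ D) (Env-[]ᵗ d)
Env-[]ᵉ (~rst D)    = cong rst (Env-[]ᵉ D)

-- Completeness of the relaxed bisimilarity

module RelaxedCompleteness where

  open Completeness bare
  open RelaxedTransitions

  Any : Tm 0 → Set
  Any _ = ⊤

  simulates : ∀ {s s′ s₁ α} → Rel Any s s′ → s —[ α ]→ʳ s₁ → ∃[ s₁′ ] (Relaxed.Weak s′ α s₁′ × Rel Any s₁ s₁′)
  simulates (terms _ _ l le ge) (tau r) =
    -- The other side answers by waiting: `Rel` survives a reduction of one side alone.
    _ , inj₁ (refl , ε) , terms tt tt l (Leᵗ-reduce (r ◅ ε) ε le) (Leᵗ-reduce ε (r ◅ ε) ge)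
  -- The test by the empty context shows that the other term reaches a value.
  simulates (terms _ _ l le ge) downT with le isValue ~□ (_ , ε , _ , refl)
  ... | _ , rs , w , refl = _ , inj₂ (_ , _ , τ*-lift rs , downT , ε) , Rel-down l rs le ge
  simulates (terms _ _ l le ge) (ctxT {𝔽 = 𝔽} st e m) with le isStuck ~□ (_ , ε , Stuck⇒ControlStuck st)
  -- Refilling the label from the other side gives `D′`, the relation over the swapped environments
  -- that `ge` asks for.
  ... | u , rs , cs with fillF-Env l 𝔽 e | fillF-Env (sym l) 𝔽
  ... | G , e′ , D | back with back e′ | ↪-total (plug G u)
  ... | F , e″ , D′ | u′ , m′ rewrite just-functional e″ e =
    _ , inj₂ (_ , _ , τ*-lift rs , ctxT (ControlStuck⇒Stuck cs) e′ m′ , ε) ,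
    terms tt tt l
      (Leᵗ-reduce (↪⇒⟶* m) (↪⇒⟶* m′) (Leᵗ-plug D (Leᵗ-reduce ε rs le)))
      (Leᵗ-reduce (↪⇒⟶* m′) (↪⇒⟶* m) (Leᵗ-plug D′ (Leᵗ-reduce rs ε ge)))
  simulates (envs {Γ} {Δ} l le ge) (lamT {i = i} {V} p e) with !!-length Γ Δ l i p | fillV-Env l V e
  ... | lam b , q | w , e′ , d with fillV-Env (sym l) V e′
  ... | v , e″ , d′ rewrite just-functional e″ e =
    _ , inj₂ (_ , _ , ε , lamT q e′ , ε) ,
    terms tt tt l (Leᵉ⇒Leᵗ-call le p q d) (Leᵉ⇒Leᵗ-call ge q p d′)

  complete : ∀ {t s} → (∀ κ F → Obs κ (plug F t) ⇔ Obs κ (plug F s)) → term [] [] t ≈env term [] [] s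
  complete h = Rel Any ,
    (simulates , λ r tr → let _ , w , r′ = simulates (Rel-sym r) tr in _ , w , Rel-sym r′) ,
    terms tt tt refl
      (λ { κ {F} D o → subst (λ G → Obs κ (plug G _)) (Env-[]ᵉ D) (Equivalence.to (h κ F) o) })
      (λ { κ {F} D o → subst (λ G → Obs κ (plug G _)) (Env-[]ᵉ D) (Equivalence.from (h κ F) o) })

-- Completeness of the original bisimilarity

Ev-unreset : ∀ {p} k → PureTerm p → Ev isValue k (reset p) → Obs isValue p
Ev-unreset k (inj₁ iv) ev = _ , ε , iv
Ev-unreset k (inj₂ (t , refl)) ev with pure-reduct t
... | p′ , r with Ev-reduce (⟶-plug (rst hole) r) ev
... | j , refl , ev′ = Obs-expand isValue (r ◅ ε) (Ev-unreset j (⟶-preserves-pure (inj₂ (t , refl)) r) ev′)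

-- A pure term takes its own steps inside an outer reset, since its own reset already stops every
-- capture. The tests observe `reset p`, whereas the `down` transition requires a value of `p`.
Obs-unreset : ∀ {p} → PureTerm p → Obs isValue (reset p) → Obs isValue p
Obs-unreset pp o = let k , ev = Obs⇒Ev isValue o in Ev-unreset k pp ev

module OriginalCompleteness where

  open Completeness delimited
  open OriginalTransitions

  simulates : ∀ {s s′ s₁ α} → Rel PureTerm s s′ → s —[ α ]→ᵒ s₁ →
              ∃[ s₁′ ] (Original.Weak s′ α s₁′ × Rel PureTerm s₁ s₁′)
  simulates (terms g g′ l le ge) (tau _ r) =
    _ , inj₁ (refl , ε) ,
    terms (⟶-preserves-pure g r) g′ l (Leᵗ-reduce (r ◅ ε) ε le) (Leᵗ-reduce ε (r ◅ ε) ge)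
  simulates (terms _ g′ l le ge) downT
    with Obs-unreset g′ (le isValue ~□ (_ , resetR hole _ ◅ ε , _ , refl))
  ... | _ , rs , w , refl = _ , inj₂ (_ , _ , τ*-lift g′ rs , downT , ε) , Rel-down l rs le ge
  simulates (envs {Γ} {Δ} l le ge) (lamT {i = i} {V} {𝔽} p e f (_ , refl))
    with !!-length Γ Δ l i p | fillV-Env l V e | fillF-Env l 𝔽 f
  -- Matching on `~rst` exhibits the other context as delimited, which the answering transition
  -- requires.
  ... | lam b , q | w , e′ , d | _ , f′ , D@(~rst _) with fillV-Env (sym l) V e′ | fillF-Env (sym l) 𝔽 f′
  ... | v , e″ , d′ | F , f″ , D′ rewrite just-functional e″ e | just-functional f″ f =
    _ , inj₂ (_ , _ , ε , lamT q e′ f′ (_ , refl) , ε) ,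
    terms (inj₂ (_ , refl)) (inj₂ (_ , refl)) l
      (Leᵗ-plug D (Leᵉ⇒Leᵗ-call le p q d)) (Leᵗ-plug D′ (Leᵉ⇒Leᵗ-call ge q p d′))

  complete : ∀ {t s} → (∀ F → Obs isValue (reset (plug F t)) ⇔ Obs isValue (reset (plug F s))) → t ≈envpTm s
  complete {t} {s} h E pE = Rel PureTerm ,
    (simulates , λ r tr → let _ , w , r′ = simulates (Rel-sym r) tr in _ , w , Rel-sym r′) ,
    terms (inj₂ (_ , refl)) (inj₂ (_ , refl)) refl (le h) (le λ F → mk⇔ (Equivalence.from (h F)) (Equivalence.to (h F)))
    where
    le : ∀ {t s} → (∀ F → Obs isValue (reset (plug F t)) ⇔ Obs isValue (reset (plug F s))) →
         Leᵗ [] [] (reset (plug E t)) (reset (plug E s))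
    -- Under the outer reset nothing becomes control-stuck, so the value tests of `≅p` cover both
    -- kinds.
    le h isStuck D o = ⊥-elim (¬Obs-stuck-reset o)
    le {t} {s} h isValue {F} D o with Env-[]ᵉ D
    ... | refl = subst (λ z → Obs isValue (reset z)) (plug-comp F (rst E) s)
      (Equivalence.to (h (compE F (rst E)))
        (subst (λ z → Obs isValue (reset z)) (sym (plug-comp F (rst E) t)) o))

theorem5p12 : (t₀ t₁ : Tm 0) →
    ((t₀ ≅ t₁) ⇔ (term [] [] t₀ ≈env term [] [] t₁)) ×
    ((t₀ ≅p t₁) ⇔ (t₀ ≈envpTm t₁))
theorem5p12 t₀ t₁ = mk⇔ completeʳ soundʳ , mk⇔ completeᵒ soundᵒ
  where
  evals : ∀ κ {t s} → (Obs κ t → Obs κ s) → EvalsTo κ t → EvalsTo κ s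
  evals κ f e = Obs⇒EvalsTo κ (f (EvalsTo⇒Obs κ e))

  observes : ∀ κ {t s} → EvalsTo κ t ⇔ EvalsTo κ s → Obs κ t ⇔ Obs κ s
  observes κ e = mk⇔ (λ o → EvalsTo⇒Obs κ (Equivalence.to e (Obs⇒EvalsTo κ o)))
                     (λ o → EvalsTo⇒Obs κ (Equivalence.from e (Obs⇒EvalsTo κ o)))

  completeʳ : t₀ ≅ t₁ → term [] [] t₀ ≈env term [] [] t₁
  completeʳ h = RelaxedCompleteness.complete λ κ F →
    subst₂ (λ a b → Obs κ a ⇔ Obs κ b) (toCtx-⟦⟧ F t₀) (toCtx-⟦⟧ F t₁) (observes κ (test κ F))
    where
    test : ∀ κ F → EvalsTo κ (toCtx F ⟦ t₀ ⟧) ⇔ EvalsTo κ (toCtx F ⟦ t₁ ⟧)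
    test isValue F = proj₁ (h 0 (toCtx F))
    test isStuck F = proj₂ (h 0 (toCtx F))

  soundʳ : term [] [] t₀ ≈env term [] [] t₁ → t₀ ≅ t₁
  soundʳ (R , (fwd , bwd) , r) n C = equiv isValue , equiv isStuck
    where
    equiv : ∀ κ → EvalsTo κ (C ⟦ t₀ ⟧) ⇔ EvalsTo κ (C ⟦ t₁ ⟧)
    equiv κ = mk⇔ (evals κ (RelaxedSoundness.sound R fwd κ C r))
                  (evals κ (RelaxedSoundness.sound (flip R) bwd κ C r))

  completeᵒ : t₀ ≅p t₁ → t₀ ≈envpTm t₁
  completeᵒ h = OriginalCompleteness.complete λ F →
    subst₂ (λ a b → Obs isValue (reset a) ⇔ Obs isValue (reset b)) (toCtx-⟦⟧ F t₀) (toCtx-⟦⟧ F t₁)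
      (observes isValue (h 0 (toCtx F)))

  soundᵒ : t₀ ≈envpTm t₁ → t₀ ≅p t₁
  soundᵒ h n C = mk⇔
    (evals isValue (originalSound (λ E p → let R , (fwd , _) , r = h E p in R , fwd , r) C))
    (evals isValue (originalSound (λ E p → let R , (_ , bwd) , r = h E p in flip R , bwd , r) C))
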